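{- Let $G$ be a projection game. (i) If $0\le\rho\le1$ and $\mathrm{val}_+(G)^2>\rho$, then $$\mathrm{val}(G)\ \ge\ \|G\|^2\ >\ \frac{1-\sqrt{1-\rho^2}}{1+\sqrt{1-\rho^2}}.$$ (ii) Contrapositively, if $0<\delta\le1$ and $\|G\|^2<\delta$, then $$\mathrm{val}_+(G)^2<\frac{2\sqrt{\delta}}{1+\delta}.$$ (iii) In particular, $\mathrm{val}_+(G)^2\le2\|G\|$ (the form of the bound when $\|G\|^2$ is small); and if $0\le\varepsilon<1$ and $\|G\|^2<1-\varepsilon$, then $\mathrm{val}_+(G)^2<1-\varepsilon^2/8$.
   Context: Projection games. A projection game $G$ is given by finite vertex sets $U,V$, a finite alphabet $\Sigma$, and a finite nonnegatively weighted bipartite multigraph between $U$ and $V$ whose edges carry constraints $\pi\subseteq\Sigma\times\Sigma$ such that for every $\beta\in\Sigma$ there is at most one $\alpha\in\Sigma$ with $(\alpha,\beta)\in\pi$. Choosing an edge with probability proportional to its weight gives a distribution on triples $(u,v,\pi)$, whose marginals are the probability measures on $U$ and $V$ (every vertex is assumed to have positive measure); $(v,\pi)|u$ denotes the distribution conditioned on $u$. The value is $\mathrm{val}(G)=\max\Pr_{(u,v,\pi)}[(f(u),g(v))\in\pi]$ over $f:U\to\Sigma$, $g:V\to\Sigma$. Collision value. $G$ is identified with the operator $Gf(u,\alpha)=\mathbb{E}_{(v,\pi)|u}\sum_{\beta:(\alpha,\beta)\in\pi}f(v,\beta)$ from functions on $V\times\Sigma$ to functions on $U\times\Sigma$, where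 $\|g\|^2=\mathbb{E}_u\sum_\alpha g(u,\alpha)^2$ for $g:U\times\Sigma\to\mathbb{R}$. An assignment is a nonnegative $f:V\times\Sigma\to\mathbb{R}$ with $\sum_\beta f(v,\beta)=1$ for all $v$; the collision value is $\|G\|=\max_f\|Gf\|$ over assignments $f$. The relaxation $\mathrm{val}_+$. For a finite measure space $\Omega$ (finite set with a measure) and $f:V\times\Sigma\times\Omega\to\mathbb{R}$, write $f_\omega(v,\beta)=f(v,\beta,\omega)$. Let $\mathrm{Id}$ be the identity on $L(\Omega)$; then $\|(G\otimes\mathrm{Id})f\|^2=\int_\Omega\|Gf_\omega\|^2d\omega$. For $v\in V$ put $\|(T_v\otimes\mathrm{Id})f\|^2=\int_\Omega\big(\sum_\beta f(v,\beta,\omega)\big)^2d\omega$. Then $$\mathrm{val}_+(G)=\sup_\Omega\ \sup_{f\ge0}\frac{\|(G\otimes\mathrm{Id})f\|}{\max_{v\in V}\|(T_v\otimes\mathrm{Id})f\|},$$ over finite measure spaces $\Omega$ and nonnegative $f$ with nonzero denominator. -}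

module Defs where

open import Algebra.Bundles using (CommutativeRing)
open import Data.Bool.Base using (Bool; T; if_then_else_)
open import Data.Fin.Base using (Fin)
open import Data.Fin.Properties using (_≟_)
open import Data.Nat.Base using (ℕ; NonZero)
open import Data.Product.Base using (Σ-syntax; ∃; _×_; _,_)
open import Level using (0ℓ)
open import Relation.Binary.Core using (Rel)
open import Relation.Binary.Structures using (IsDecTotalOrder)
open import Relation.Binary.PropositionalEquality.Core using (_≡_)
open import Relation.Nullary.Decidable.Core using (⌊_⌋)
open import Relation.Nullary.Negation.Core using (¬_)
import Algebra.Properties.CommutativeMonoid.Sum as CommutativeMonoidSum
import Relation.Binary.Construct.NonStrictToStrict as ToStrict

-- The standard library has no real numbers, so ℝ is axiomatised, in the
-- classical sense, as a Dedekind-complete ordered field; this determines it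
-- up to isomorphism.  Inversion and sup are total operations, constrained
-- only where they are meaningful: _⁻¹ away from zero, sup on inhabited sets
-- that are bounded above.
record CompleteOrderedField : Set₁ where
  field
    commutativeRing : CommutativeRing 0ℓ 0ℓ

  open CommutativeRing commutativeRing public

  infix  4 _≤_
  infix  8 _⁻¹

  field
    _≤_             : Rel Carrier 0ℓ
    isDecTotalOrder : IsDecTotalOrder _≈_ _≤_
    +-monoʳ-≤       : ∀ z {x y} → x ≤ y → z + x ≤ z + y
    *-nonNegative   : ∀ {x y} → 0# ≤ x → 0# ≤ y → 0# ≤ x * y
    0≉1             : ¬ (0# ≈ 1#)
    _⁻¹             : Carrier → Carrier
    ⁻¹-cong         : ∀ {x y} → x ≈ y → x ⁻¹ ≈ y ⁻¹
    ⁻¹-inverseʳ     : ∀ {x} → ¬ (x ≈ 0#) → x * x ⁻¹ ≈ 1#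

  IsUpperBound : (Carrier → Set) → Carrier → Set
  IsUpperBound S b = ∀ x → S x → x ≤ b

  IsLeastUpperBound : (Carrier → Set) → Carrier → Set
  IsLeastUpperBound S s = IsUpperBound S s × (∀ b → IsUpperBound S b → s ≤ b)

  field
    sup                   : (Carrier → Set) → Carrier
    sup-isLeastUpperBound : ∀ S → ∃ S → ∃ (IsUpperBound S) →
                            IsLeastUpperBound S (sup S)

  open ToStrict _≈_ _≤_ public using (_<_)
  open CommutativeMonoidSum +-commutativeMonoid public using (sum-syntax)

  infixl 7 _/_
  infix  9 _²

  _/_ : Carrier → Carrier → Carrier
  x / y = x * y ⁻¹

  _² : Carrier → Carrier
  x ² = x * x

  2# 8# : Carrier
  2# = 1# + 1#
  8# = 2# * (2# * 2#)

  -- The nonnegative square root when 0# ≤ x; meaningless otherwise.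
  √ : Carrier → Carrier
  √ x = sup (λ y → y ² ≤ x)

  ⨆ : {I : Set} → (I → Carrier) → Carrier
  ⨆ {I} F = sup (λ x → Σ[ i ∈ I ] x ≈ F i)

  indicator : Bool → Carrier
  indicator b = if b then 1# else 0#

module ProjectionGames (ℝ : CompleteOrderedField) where

  open CompleteOrderedField ℝ

  -- An edge is an element of Fin |E|, so parallel edges are allowed.
  record ProjectionGame : Set where
    field
      |U| |V| |Σ| |E| : ℕ
      Σ-nonEmpty      : NonZero |Σ|

    U : Set
    U = Fin |U|

    V : Set
    V = Fin |V|

    Alphabet : Set
    Alphabet = Fin |Σ|

    Edge : Set
    Edge = Fin |E|

    field
      left                 : Edge → U
      right                : Edge → V
      weight               : Edge → Carrier
      weight-nonNegative   : ∀ e → 0# ≤ weight e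
      -- T (constraint e α β) says that (α , β) lies in the constraint of e.
      constraint           : Edge → Alphabet → Alphabet → Bool
      projection           : ∀ e {α α′} β → T (constraint e α β) →
                             T (constraint e α′ β) → α ≡ α′

    totalWeight : Carrier
    totalWeight = ∑[ e < |E| ] weight e

    probability : Edge → Carrier
    probability e = weight e / totalWeight

    measureU : U → Carrier
    measureU u = ∑[ e < |E| ] (indicator ⌊ left e ≟ u ⌋ * probability e)

    measureV : V → Carrier
    measureV v = ∑[ e < |E| ] (indicator ⌊ right e ≟ v ⌋ * probability e)

    field
      totalWeight-positive : 0# < totalWeight
      measureU-positive    : ∀ u → 0# < measureU u
      measureV-positive    : ∀ v → 0# < measureV v

    -- The probability of drawing e conditioned on its left endpoint being u.
    conditional : U → Edge → Carrier
    conditional u e = indicator ⌊ left e ≟ u ⌋ * probability e / measureU u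

  record FiniteMeasureSpace : Set where
    field
      size                : ℕ
      measure             : Fin size → Carrier
      measure-nonNegative : ∀ ω → 0# ≤ measure ω

    ∫ : (Fin size → Carrier) → Carrier
    ∫ h = ∑[ ω < size ] (measure ω * h ω)

  module _ (G : ProjectionGame) where

    open ProjectionGame G

    agreement : (U → Alphabet) → (V → Alphabet) → Carrier
    agreement f g = ∑[ e < |E| ]
      (probability e * indicator (constraint e (f (left e)) (g (right e))))

    val : Carrier
    val = ⨆ {I = (U → Alphabet) × (V → Alphabet)}
            (λ (f , g) → agreement f g)

    operator : (V → Alphabet → Carrier) → (U → Alphabet → Carrier)
    operator f u α = ∑[ e < |E| ]
      (conditional u e *
        (∑[ β < |Σ| ] (indicator (constraint e α β) * f (right e) β)))

    normSquared : (U → Alphabet → Carrier) → Carrier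
    normSquared g = ∑[ u < |U| ] (measureU u * (∑[ α < |Σ| ] (g u α ²)))

    norm : (U → Alphabet → Carrier) → Carrier
    norm g = √ (normSquared g)

    record IsAssignment (f : V → Alphabet → Carrier) : Set where
      field
        nonNegative : ∀ v β → 0# ≤ f v β
        normalised  : ∀ v → (∑[ β < |Σ| ] f v β) ≈ 1#

    -- The maximum over assignments is written as a supremum; it is attained
    -- because the norm is convex and the assignments form a polytope.
    collisionValue : Carrier
    collisionValue = ⨆ {I = Σ[ f ∈ (V → Alphabet → Carrier) ] IsAssignment f}
                       (λ (f , _) → norm (operator f))

    module _ (Ω : FiniteMeasureSpace) where

      open FiniteMeasureSpace Ω

      VectorAssignment : Set
      VectorAssignment = V → Alphabet → Fin size → Carrier

      normG⊗Id : VectorAssignment → Carrier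
      normG⊗Id f =
        √ (∫ (λ ω → normSquared (operator (λ v β → f v β ω))))

      normT⊗Id : V → VectorAssignment → Carrier
      normT⊗Id v f = √ (∫ (λ ω → (∑[ β < |Σ| ] f v β ω) ²))

      maxNormT⊗Id : VectorAssignment → Carrier
      maxNormT⊗Id f = ⨆ (λ v → normT⊗Id v f)

      record IsAdmissible (f : VectorAssignment) : Set where
        field
          nonNegative         : ∀ v β ω → 0# ≤ f v β ω
          denominator-nonZero : ¬ (maxNormT⊗Id f ≈ 0#)

    -- A single supremum over pairs (Ω , f), so that measure spaces carrying
    -- no admissible f do not contribute.
    val₊ : Carrier
    val₊ = ⨆ {I = Σ[ Ω ∈ FiniteMeasureSpace ]
                  Σ[ f ∈ VectorAssignment Ω ] IsAdmissible Ω f}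
             (λ (Ω , f , _) → normG⊗Id Ω f / maxNormT⊗Id Ω f)

{-# OPTIONS --safe #-}

-- All three parts follow from val₊² (1 + c²) ≤ 2c, where c is the collision
-- value.  Expanding squares, ‖G f‖² is a weighted average, over pairs (e , e′) of
-- edges with a common left endpoint, of the probability that f projects to the
-- same letter along both.  For a vector assignment f let F v ω = ∑ f v β ω.
-- Normalising f at (v , ω) and keeping it on the level sets of F² gives a random
-- partial assignment; with A and M the masses with which the two ends of a pair
-- are both defined and agree, respectively are not both undefined, AM-GM for
-- min(F², F′²) and max(F², F′²) bounds the correlation ρ of the pair by
-- 2tρ ≤ A + t² M, while A + M ≤ 2 max ‖T f‖².  Correlated sampling turns the
-- partial assignment into one that makes each pair agree with probability
-- q = A / M, so the average of q is at most c².  Since the resulting bound on ρ is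
-- concave in q, the average of ρ is bounded by its tangent line at q = t² = c².
module Submission where

-- Level sets of `F²`, rather than of `F`, are used because the minimum and the maximum of `F²` and
-- `F′²` have product `(F F′)²`: their geometric mean is exactly the factor `F F′` by which
-- normalising scales a pair. The agreement rates `q` vary from pair to pair and only their average
-- is controlled, so the bound on `ρ` has to be made linear in `q`. One `t` therefore serves all
-- pairs in AM-GM, instead of the best choice `t² = q` for each. With `d = max ‖T f‖²` the two mass
-- inequalities give `tρ ≤ d (q + t²) / (1 + q) = d (1 - (1 - t²) / (1 + q))`, and `1 / (1 +
-- q)` lies above its tangent `(2b - (1 + q)) / b²` for `b = 1 + t²`. At the point of tangency the
-- bound reads `ρ ≤ 2td / (1 + t²)`, the origin of `2c / (1 + c²)`. Since `t` has to be cancelled,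
-- the estimate is proved for every `t` with `0 < t ≤ 1` and `c ≤ t`, and `c = 0` is reached through
-- small `t`.

open import Defs
open import Algebra.Bundles using (CommutativeRing)
open import Algebra.Solver.Ring.AlmostCommutativeRing using (_-Raw-AlmostCommutative⟶_; fromCommutativeRing)
open import Data.Bool.Base using (Bool; true; false; T)
open import Data.Empty using (⊥-elim)
open import Data.Fin.Base using (Fin; zero; suc)
open import Data.Integer.Base as ℤ using (ℤ; +_; -[1+_])
open import Data.List.Base using (List; []; _∷_; tabulate)
open import Data.List.Membership.Propositional using (_∈_)
open import Data.List.Membership.Propositional.Properties using (∈-tabulate⁺; ∈-tabulate⁻)
open import Data.List.Relation.Binary.Permutation.Propositional using (↭-sym)
open import Data.List.Relation.Binary.Permutation.Propositional.Properties using (∈-resp-↭)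
open import Data.List.Relation.Unary.All as All using (All)
open import Data.List.Relation.Unary.AllPairs using (AllPairs; []; _∷_)
open import Data.List.Relation.Unary.Any using (here; there)
open import Data.List.Relation.Unary.Linked.Properties using (Linked⇒AllPairs)
open import Data.Maybe.Base using (Maybe; just; nothing)
open import Data.Nat.Base as ℕ using (ℕ; zero; suc; NonZero)
open import Data.Product.Base using (Σ-syntax; ∃; _×_; _,_; proj₁; proj₂)
open import Data.Sum.Base using (_⊎_; inj₁; inj₂)
open import Level using (0ℓ)
open import Relation.Binary.Bundles using (DecTotalOrder)
open import Relation.Binary.PropositionalEquality.Core as ≡ using (_≡_)
open import Relation.Binary.Structures using (IsDecTotalOrder)
open import Relation.Nullary.Decidable.Core using (yes; no; ⌊_⌋; decidable-stable)
open import Relation.Nullary.Negation.Core using (¬_; contradiction)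
import Algebra.Properties.Ring as RingProperties
import Algebra.Properties.Semiring.Mult.TCOptimised as Mult
import Algebra.Properties.Semiring.Sum as SemiringSum
import Algebra.Solver.Ring as RingSolver
import Data.Fin.Properties as Fin
import Data.Integer.Properties as ℤ
import Data.List.Sort as Sort
import Relation.Binary.Construct.NonStrictToStrict as ToStrict
import Relation.Binary.Reasoning.PartialOrder as PartialOrderReasoning
import Relation.Binary.Reasoning.Setoid as SetoidReasoning

-- The ring solver with integer coefficients, so that subtractions cancel in an
-- abstract ring.
module IntegerCoefficients (R : CommutativeRing 0ℓ 0ℓ) where

  open CommutativeRing R
  open RingProperties ring
  open Mult semiring renaming (_×_ to _·_)
  open SetoidReasoning setoid

  ⟦_⟧ᶻ : ℤ → Carrier
  ⟦ + n ⟧ᶻ      = n · 1#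
  ⟦ -[1+ n ] ⟧ᶻ = - (suc n · 1#)

  ⟦⟧ᶻ-homo-neg : ∀ i → ⟦ ℤ.- i ⟧ᶻ ≈ - ⟦ i ⟧ᶻ
  ⟦⟧ᶻ-homo-neg (+ zero)  = sym -0#≈0#
  ⟦⟧ᶻ-homo-neg (+ suc n) = refl
  ⟦⟧ᶻ-homo-neg -[1+ n ]  = sym (-‿involutive _)

  ⟦⟧ᶻ-homo-⊖ : ∀ m n → ⟦ m ℤ.⊖ n ⟧ᶻ ≈ m · 1# - n · 1#
  ⟦⟧ᶻ-homo-⊖ zero    zero    = sym (-‿inverseʳ 0#)
  ⟦⟧ᶻ-homo-⊖ zero    (suc n) = sym (+-identityˡ _)
  ⟦⟧ᶻ-homo-⊖ (suc m) zero    = sym (trans (+-congˡ -0#≈0#) (+-identityʳ _))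
  ⟦⟧ᶻ-homo-⊖ (suc m) (suc n) = begin
    ⟦ suc m ℤ.⊖ suc n ⟧ᶻ                ≡⟨ ≡.cong ⟦_⟧ᶻ (ℤ.[1+m]⊖[1+n]≡m⊖n m n) ⟩
    ⟦ m ℤ.⊖ n ⟧ᶻ                        ≈⟨ ⟦⟧ᶻ-homo-⊖ m n ⟩
    m · 1# - n · 1#                     ≈⟨ +-congʳ (+-identityʳ _) ⟨
    m · 1# + 0# - n · 1#                ≈⟨ +-congʳ (+-congˡ (-‿inverseʳ 1#)) ⟨
    m · 1# + (1# - 1#) - n · 1#         ≈⟨ +-congʳ (+-assoc _ _ _) ⟨
    m · 1# + 1# - 1# - n · 1#           ≈⟨ +-assoc _ _ _ ⟩
    m · 1# + 1# + (- 1# - n · 1#)       ≈⟨ +-cong (+-comm _ _) (-‿+-comm _ _) ⟩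
    1# + m · 1# - (1# + n · 1#)         ≈⟨ +-cong (1+× m 1#) (-‿cong (1+× n 1#)) ⟨
    suc m · 1# - suc n · 1#             ∎

  ⟦⟧ᶻ-homo-+ : ∀ i j → ⟦ i ℤ.+ j ⟧ᶻ ≈ ⟦ i ⟧ᶻ + ⟦ j ⟧ᶻ
  ⟦⟧ᶻ-homo-+ (+ m)    (+ n)    = ×-homo-+ 1# m n
  ⟦⟧ᶻ-homo-+ (+ m)    -[1+ n ] = ⟦⟧ᶻ-homo-⊖ m (suc n)
  ⟦⟧ᶻ-homo-+ -[1+ m ] (+ n)    = trans (⟦⟧ᶻ-homo-⊖ n (suc m)) (+-comm _ _)
  ⟦⟧ᶻ-homo-+ -[1+ m ] -[1+ n ] = begin
    - (suc (suc (m ℕ.+ n)) · 1#)      ≈⟨ -‿cong (1+× (suc (m ℕ.+ n)) 1#) ⟩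
    - (1# + (suc m ℕ.+ n) · 1#)       ≈⟨ -‿cong (+-congˡ (×-homo-+ 1# (suc m) n)) ⟩
    - (1# + (suc m · 1# + n · 1#))    ≈⟨ -‿cong (+-assoc _ _ _) ⟨
    - (1# + suc m · 1# + n · 1#)      ≈⟨ -‿cong (+-congʳ (+-comm _ _)) ⟩
    - (suc m · 1# + 1# + n · 1#)      ≈⟨ -‿cong (+-assoc _ _ _) ⟩
    - (suc m · 1# + (1# + n · 1#))    ≈⟨ -‿cong (+-congˡ (1+× n 1#)) ⟨
    - (suc m · 1# + suc n · 1#)       ≈⟨ -‿+-comm _ _ ⟨
    - (suc m · 1#) - suc n · 1#       ∎

  ⟦⟧ᶻ-homo-* : ∀ i j → ⟦ i ℤ.* j ⟧ᶻ ≈ ⟦ i ⟧ᶻ * ⟦ j ⟧ᶻ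
  ⟦⟧ᶻ-homo-* (+ m) (+ n) = begin
    ⟦ + m ℤ.* + n ⟧ᶻ        ≡⟨ ≡.cong ⟦_⟧ᶻ (ℤ.+◃n≡+n (m ℕ.* n)) ⟩
    (m ℕ.* n) · 1#          ≈⟨ ×1-homo-* m n ⟩
    m · 1# * (n · 1#)       ∎
  ⟦⟧ᶻ-homo-* (+ m) -[1+ n ] = begin
    ⟦ + m ℤ.* -[1+ n ] ⟧ᶻ       ≡⟨ ≡.cong ⟦_⟧ᶻ (ℤ.-◃n≡-n (m ℕ.* suc n)) ⟩
    ⟦ ℤ.- + (m ℕ.* suc n) ⟧ᶻ    ≈⟨ ⟦⟧ᶻ-homo-neg (+ (m ℕ.* suc n)) ⟩
    - ((m ℕ.* suc n) · 1#)      ≈⟨ -‿cong (×1-homo-* m (suc n)) ⟩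
    - (m · 1# * (suc n · 1#))   ≈⟨ -‿distribʳ-* _ _ ⟩
    m · 1# * - (suc n · 1#)     ∎
  ⟦⟧ᶻ-homo-* -[1+ m ] (+ n) = begin
    ⟦ -[1+ m ] ℤ.* + n ⟧ᶻ       ≡⟨ ≡.cong ⟦_⟧ᶻ (ℤ.-◃n≡-n (suc m ℕ.* n)) ⟩
    ⟦ ℤ.- + (suc m ℕ.* n) ⟧ᶻ    ≈⟨ ⟦⟧ᶻ-homo-neg (+ (suc m ℕ.* n)) ⟩
    - ((suc m ℕ.* n) · 1#)      ≈⟨ -‿cong (×1-homo-* (suc m) n) ⟩
    - (suc m · 1# * (n · 1#))   ≈⟨ -‿distribˡ-* _ _ ⟩
    - (suc m · 1#) * (n · 1#)   ∎
  ⟦⟧ᶻ-homo-* -[1+ m ] -[1+ n ] = begin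
    (suc m ℕ.* suc n) · 1#            ≈⟨ ×1-homo-* (suc m) (suc n) ⟩
    suc m · 1# * (suc n · 1#)         ≈⟨ -‿involutive _ ⟨
    - - (suc m · 1# * (suc n · 1#))   ≈⟨ -‿cong (-‿distribˡ-* _ _) ⟩
    - (- (suc m · 1#) * (suc n · 1#)) ≈⟨ -‿distribʳ-* _ _ ⟩
    - (suc m · 1#) * - (suc n · 1#)   ∎

  ⟦⟧ᶻ-homomorphism : ℤ.+-*-rawRing -Raw-AlmostCommutative⟶ fromCommutativeRing R
  ⟦⟧ᶻ-homomorphism = record
    { ⟦_⟧    = ⟦_⟧ᶻ
    ; +-homo = ⟦⟧ᶻ-homo-+
    ; *-homo = ⟦⟧ᶻ-homo-*
    ; -‿homo = ⟦⟧ᶻ-homo-neg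
    ; 0-homo = refl
    ; 1-homo = refl
    }

  _≟ᶻ_ : ∀ i j → Maybe (⟦ i ⟧ᶻ ≈ ⟦ j ⟧ᶻ)
  i ≟ᶻ j with i ℤ.≟ j
  ... | yes i≡j = just (reflexive (≡.cong ⟦_⟧ᶻ i≡j))
  ... | no  _   = nothing

  open RingSolver ℤ.+-*-rawRing (fromCommutativeRing R) ⟦⟧ᶻ-homomorphism _≟ᶻ_ public
    using (solve; _:=_; con; _:+_; _:*_; _:-_; :-_)

-- Order arithmetic, square roots and suprema in a complete ordered field.

module OrderedFieldProperties (ℝ : CompleteOrderedField) where

  open CompleteOrderedField ℝ
  open IsDecTotalOrder isDecTotalOrder public
    using (_≟_; _≤?_)
    renaming ( refl to ≤-refl; trans to ≤-trans; antisym to ≤-antisym; total to ≤-total; reflexive to ≤-reflexive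
             ; ≤-respˡ-≈ to ≤-respˡ; ≤-respʳ-≈ to ≤-respʳ)
  open IntegerCoefficients commutativeRing public

  decTotalOrder : DecTotalOrder 0ℓ 0ℓ 0ℓ
  decTotalOrder = record { isDecTotalOrder = isDecTotalOrder }

  open DecTotalOrder decTotalOrder public using (poset)

  ≰⇒> : ∀ {x y} → ¬ (x ≤ y) → y < x
  ≰⇒> = ToStrict.≰⇒> _≈_ _≤_ sym ≤-reflexive ≤-total

  <⇒≱ : ∀ {x y} → x < y → ¬ (y ≤ x)
  <⇒≱ = ToStrict.<⇒≱ _≈_ _≤_ ≤-antisym

  ≤-stable : ∀ {x y} → ¬ (y < x) → x ≤ y
  ≤-stable {x} {y} y≮x = decidable-stable (x ≤? y) λ x≰y → y≮x (≰⇒> x≰y)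

  +-mono-≤ : ∀ {x y u v} → x ≤ y → u ≤ v → x + u ≤ y + v
  +-mono-≤ {x} {y} {u} {v} x≤y u≤v = ≤-trans (+-monoʳ-≤ x u≤v)
    (≤-respˡ (+-comm v x) (≤-respʳ (+-comm v y) (+-monoʳ-≤ v x≤y)))

  x≤y⇒0≤y-x : ∀ {x y} → x ≤ y → 0# ≤ y - x
  x≤y⇒0≤y-x {x} {y} x≤y = ≤-respˡ (-‿inverseˡ x) (≤-respʳ (+-comm (- x) y) (+-monoʳ-≤ (- x) x≤y))

  ≤-from-difference : ∀ {x y d} → y - x ≈ d → 0# ≤ d → x ≤ y
  ≤-from-difference {x} {y} {d} y-x≈d 0≤d = ≤-respˡ (+-identityʳ x) (≤-respʳ x+d≈y (+-monoʳ-≤ x 0≤d))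
    where
    x+d≈y : x + d ≈ y
    x+d≈y = trans (+-congˡ (sym y-x≈d)) (solve 2 (λ x y → x :+ (y :- x) := y) refl x y)

  +-nonNegative : ∀ {x y} → 0# ≤ x → 0# ≤ y → 0# ≤ x + y
  +-nonNegative 0≤x 0≤y = ≤-respˡ (+-identityˡ 0#) (+-mono-≤ 0≤x 0≤y)

  ²-nonNegative : ∀ x → 0# ≤ x ²
  ²-nonNegative x with ≤-total 0# x
  ... | inj₁ 0≤x = *-nonNegative 0≤x 0≤x
  ... | inj₂ x≤0 = ≤-respʳ (solve 1 (λ x → (con (+ 0) :- x) :* (con (+ 0) :- x) := x :* x) refl x)
                     (*-nonNegative (x≤y⇒0≤y-x x≤0) (x≤y⇒0≤y-x x≤0))

  0≤1 : 0# ≤ 1#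
  0≤1 = ≤-respʳ (*-identityʳ 1#) (²-nonNegative 1#)

  0<1 : 0# < 1#
  0<1 = 0≤1 , 0≉1

  0≤2 : 0# ≤ 2#
  0≤2 = +-nonNegative 0≤1 0≤1

  *-monoˡ-≤ : ∀ {z x y} → 0# ≤ z → x ≤ y → z * x ≤ z * y
  *-monoˡ-≤ {z} {x} {y} 0≤z x≤y = ≤-from-difference
    (solve 3 (λ x y z → z :* y :- z :* x := z :* (y :- x)) refl x y z) (*-nonNegative 0≤z (x≤y⇒0≤y-x x≤y))

  *-monoʳ-≤ : ∀ {z x y} → 0# ≤ z → x ≤ y → x * z ≤ y * z
  *-monoʳ-≤ 0≤z x≤y = ≤-respˡ (*-comm _ _) (≤-respʳ (*-comm _ _) (*-monoˡ-≤ 0≤z x≤y))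

  *-mono-≤ : ∀ {x y u v} → 0# ≤ x → 0# ≤ v → x ≤ y → u ≤ v → x * u ≤ y * v
  *-mono-≤ 0≤x 0≤v x≤y u≤v = ≤-trans (*-monoˡ-≤ 0≤x u≤v) (*-monoʳ-≤ 0≤v x≤y)

  ²-mono-≤ : ∀ {x y} → 0# ≤ x → x ≤ y → x ² ≤ y ²
  ²-mono-≤ 0≤x x≤y = *-mono-≤ 0≤x (≤-trans 0≤x x≤y) x≤y x≤y

  ²-cong : ∀ {x y} → x ≈ y → x ² ≈ y ²
  ²-cong x≈y = *-cong x≈y x≈y

  <-≤-trans : ∀ {x y z} → x < y → y ≤ z → x < z
  <-≤-trans x<y y≤z = ≰⇒> λ z≤x → <⇒≱ x<y (≤-trans y≤z z≤x)

  ≤-<-trans : ∀ {x y z} → x ≤ y → y < z → x < z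
  ≤-<-trans x≤y y<z = ≰⇒> λ z≤x → <⇒≱ y<z (≤-trans z≤x x≤y)

  <-respʳ : ∀ {x y z} → y ≈ z → x < y → x < z
  <-respʳ y≈z x<y = <-≤-trans x<y (≤-reflexive y≈z)

  +-positive : ∀ {x y} → 0# < x → 0# ≤ y → 0# < x + y
  +-positive {x} {y} 0<x 0≤y = <-≤-trans 0<x (≤-respˡ (+-identityʳ x) (+-monoʳ-≤ x 0≤y))

  x<y⇒0<y-x : ∀ {x y} → x < y → 0# < y - x
  x<y⇒0<y-x {x} {y} x<y = ≰⇒> λ y-x≤0 → <⇒≱ x<y (≤-from-difference
    (solve 2 (λ x y → x :- y := con (+ 0) :- (y :- x)) refl x y) (x≤y⇒0≤y-x y-x≤0))

  x*y≈0⇒y≈0 : ∀ {x y} → ¬ (x ≈ 0#) → x * y ≈ 0# → y ≈ 0#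
  x*y≈0⇒y≈0 {x} {y} x≉0 xy≈0 = begin
    y                  ≈⟨ *-identityˡ y ⟨
    1# * y             ≈⟨ *-congʳ (⁻¹-inverseʳ x≉0) ⟨
    x * x ⁻¹ * y       ≈⟨ solve 3 (λ x i y → x :* i :* y := i :* (x :* y)) refl x (x ⁻¹) y ⟩
    x ⁻¹ * (x * y)     ≈⟨ *-congˡ xy≈0 ⟩
    x ⁻¹ * 0#          ≈⟨ zeroʳ _ ⟩
    0#                 ∎
    where open SetoidReasoning setoid

  *-positive : ∀ {x y} → 0# < x → 0# < y → 0# < x * y
  *-positive (0≤x , 0≉x) (0≤y , 0≉y) =
    *-nonNegative 0≤x 0≤y , λ 0≈xy → 0≉y (sym (x*y≈0⇒y≈0 (λ x≈0 → 0≉x (sym x≈0)) (sym 0≈xy)))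

  0<2 : 0# < 2#
  0<2 = +-positive 0<1 0≤1

  0<8 : 0# < 8#
  0<8 = *-positive 0<2 (*-positive 0<2 0<2)

  0<⇒≉0 : ∀ {x} → 0# < x → ¬ (x ≈ 0#)
  0<⇒≉0 (_ , 0≉x) x≈0 = 0≉x (sym x≈0)

  x≈0⇒x²≈0 : ∀ {x} → x ≈ 0# → x ² ≈ 0#
  x≈0⇒x²≈0 x≈0 = trans (*-congʳ x≈0) (zeroˡ _)

  *-cancelˡ-≤ : ∀ {z x y} → 0# < z → z * x ≤ z * y → x ≤ y
  *-cancelˡ-≤ {z} {x} {y} 0<z zx≤zy = ≤-stable λ y<x → <⇒≱ (*-positive 0<z (x<y⇒0<y-x y<x))
    (≤-from-difference (solve 3 (λ x y z → con (+ 0) :- z :* (x :- y) := z :* y :- z :* x) refl x y z)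
      (x≤y⇒0≤y-x zx≤zy))

  ⁻¹-positive : ∀ {x} → 0# < x → 0# < x ⁻¹
  ⁻¹-positive {x} 0<x@(0≤x , _) =
    ≤-respʳ x*x⁻²≈x⁻¹ (*-nonNegative 0≤x (²-nonNegative (x ⁻¹))) ,
    λ 0≈x⁻¹ → 0≉1 (trans (sym (zeroʳ x)) (trans (*-congˡ 0≈x⁻¹) (⁻¹-inverseʳ (0<⇒≉0 0<x))))
    where
    x*x⁻²≈x⁻¹ : x * (x ⁻¹) ² ≈ x ⁻¹
    x*x⁻²≈x⁻¹ = trans (sym (*-assoc _ _ _))
                  (trans (*-congʳ (⁻¹-inverseʳ (0<⇒≉0 0<x))) (*-identityˡ _))

  /-cancelʳ : ∀ {x y} → ¬ (y ≈ 0#) → x / y * y ≈ x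
  /-cancelʳ {x} {y} y≉0 = trans (*-assoc x _ y) (trans (*-congˡ (trans (*-comm _ y) (⁻¹-inverseʳ y≉0))) (*-identityʳ x))

  /-nonNegative : ∀ {x y} → 0# ≤ x → 0# < y → 0# ≤ x / y
  /-nonNegative 0≤x 0<y = *-nonNegative 0≤x (proj₁ (⁻¹-positive 0<y))

  ≤-/ : ∀ {x y z} → 0# < z → x * z ≤ y → x ≤ y / z
  ≤-/ {x} {y} {z} 0<z xz≤y = *-cancelˡ-≤ 0<z (≤-respˡ (*-comm x z) (≤-respʳ
    (trans (sym (/-cancelʳ (0<⇒≉0 0<z))) (*-comm _ z)) xz≤y))

  /-≤ : ∀ {x y z} → 0# < z → x ≤ y * z → x / z ≤ y
  /-≤ {x} {y} {z} 0<z x≤yz = *-cancelˡ-≤ 0<z (≤-respʳ (*-comm y z) (≤-respˡ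
    (trans (sym (/-cancelʳ (0<⇒≉0 0<z))) (*-comm _ z)) x≤yz))

  /-<-cross : ∀ {x y z} → 0# < z → x < y * z → x / z < y
  /-<-cross {x} {y} {z} 0<z x<yz = ≰⇒> λ y≤x/z → <⇒≱ x<yz
    (≤-respʳ (/-cancelʳ (0<⇒≉0 0<z)) (*-monoʳ-≤ (proj₁ 0<z) y≤x/z))

  <-/-cross : ∀ {x y z} → 0# < z → x * z < y → x < y / z
  <-/-cross {x} {y} {z} 0<z xz<y = ≰⇒> λ y/z≤x → <⇒≱ xz<y
    (≤-respˡ (/-cancelʳ (0<⇒≉0 0<z)) (*-monoʳ-≤ (proj₁ 0<z) y/z≤x))

  ²-cancel-≤ : ∀ {x y} → 0# ≤ y → x ² ≤ y ² → x ≤ y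
  ²-cancel-≤ {x} {y} 0≤y x²≤y² = ≤-stable λ y<x →
    <⇒≱ (*-positive (x<y⇒0<y-x y<x) (+-positive (≤-<-trans 0≤y y<x) 0≤y))
      (≤-from-difference (solve 2 (λ x y → con (+ 0) :- (x :- y) :* (x :+ y) := y :* y :- x :* x) refl x y)
        (x≤y⇒0≤y-x x²≤y²))

  -- With d = |s² - x| and e = d / (2s + 1 + d), a failure of s² ≈ x is
  -- contradicted by s + e (too small) or by the upper bound s - e (too large).
  module _ {x} (0≤x : 0# ≤ x) where

    private
      S : Carrier → Set
      S y = y ² ≤ x

      S-bounded : IsUpperBound S (1# + x)
      S-bounded y y²≤x = ²-cancel-≤ (+-nonNegative 0≤1 0≤x) (≤-trans y²≤x (≤-from-difference
        (solve 1 (λ x → (con (+ 1) :+ x) :* (con (+ 1) :+ x) :- x := con (+ 1) :+ x :+ x :* x) refl x)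
        (+-nonNegative (+-nonNegative 0≤1 0≤x) (²-nonNegative x))))

      s : Carrier
      s = √ x

      S0 : S 0#
      S0 = ≤-respˡ (sym (zeroˡ 0#)) 0≤x

      s-lub : IsLeastUpperBound S s
      s-lub = sup-isLeastUpperBound S (0# , S0) (1# + x , S-bounded)

    ≤-√ : ∀ {y} → y ² ≤ x → y ≤ s
    ≤-√ {y} = proj₁ s-lub y

    √-nonNegative : 0# ≤ s
    √-nonNegative = ≤-√ S0

    private
      module Step {d} (0<d : 0# < d) where

        k e : Carrier
        k = 2# * s + 1# + d
        e = d / k

        0<k : 0# < k
        0<k = +-positive (<-respʳ (+-comm _ _) (+-positive 0<1 (*-nonNegative 0≤2 √-nonNegative))) (proj₁ 0<d)

        0<e : 0# < e
        0<e = *-positive 0<d (⁻¹-positive 0<k)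

        ek≈d : e * k ≈ d
        ek≈d = /-cancelʳ (0<⇒≉0 0<k)

        e≤1 : e ≤ 1#
        e≤1 = /-≤ 0<k (≤-from-difference
          (solve 2 (λ s d → con (+ 1) :* (con (+ 2) :* s :+ con (+ 1) :+ d) :- d := con (+ 2) :* s :+ con (+ 1)) refl s d)
          (+-nonNegative (*-nonNegative 0≤2 √-nonNegative) 0≤1))

    √²≤ : s ² ≤ x
    √²≤ = ≤-stable λ x<s² → let open Step (x<y⇒0<y-x x<s²) in
      let 0≤s-e : 0# ≤ s - e
          0≤s-e = x≤y⇒0≤y-x (/-≤ 0<k (≤-from-difference
            (solve 2 (λ s x → s :* (con (+ 2) :* s :+ con (+ 1) :+ (s :* s :- x)) :- (s :* s :- x)
                               := s :* s :+ s :+ s :* (s :* s :- x) :+ x) refl s x)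
            (+-nonNegative (+-nonNegative (+-nonNegative (²-nonNegative s) √-nonNegative)
              (*-nonNegative √-nonNegative (x≤y⇒0≤y-x (proj₁ x<s²)))) 0≤x)))
          x≤[s-e]² : x ≤ (s - e) ²
          x≤[s-e]² = ≤-from-difference
            (trans (solve 3 (λ s x e → (s :- e) :* (s :- e) :- x
                               := (s :* s :- x) :- e :* (con (+ 2) :* s :+ con (+ 1) :+ (s :* s :- x))
                                  :+ (e :* e :+ e :* (con (+ 1) :+ (s :* s :- x)))) refl s x e)
              (trans (+-congʳ (trans (+-congˡ (-‿cong ek≈d)) (-‿inverseʳ _))) (+-identityˡ _)))
            (+-nonNegative (²-nonNegative e) (*-nonNegative (proj₁ 0<e)
              (+-nonNegative 0≤1 (x≤y⇒0≤y-x (proj₁ x<s²)))))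
          s≤s-e : s ≤ s - e
          s≤s-e = proj₂ s-lub (s - e) λ y y²≤x → ²-cancel-≤ 0≤s-e (≤-trans y²≤x x≤[s-e]²)
      in <⇒≱ 0<e (≤-from-difference (solve 2 (λ s e → con (+ 0) :- e := (s :- e) :- s) refl s e) (x≤y⇒0≤y-x s≤s-e))

    ≤√² : x ≤ s ²
    ≤√² = ≤-stable λ s²<x → let open Step (x<y⇒0<y-x s²<x) in
      let [s+e]²≤x : (s + e) ² ≤ x
          [s+e]²≤x = ≤-from-difference
            (trans (solve 3 (λ s x e → x :- (s :+ e) :* (s :+ e)
                               := (x :- s :* s) :- e :* (con (+ 2) :* s :+ con (+ 1) :+ (x :- s :* s))
                                  :+ e :* ((con (+ 1) :- e) :+ (x :- s :* s))) refl s x e)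
              (trans (+-congʳ (trans (+-congˡ (-‿cong ek≈d)) (-‿inverseʳ _))) (+-identityˡ _)))
            (*-nonNegative (proj₁ 0<e) (+-nonNegative (x≤y⇒0≤y-x e≤1) (x≤y⇒0≤y-x (proj₁ s²<x))))
      in <⇒≱ 0<e (≤-from-difference (solve 2 (λ s e → con (+ 0) :- e := s :- (s :+ e)) refl s e)
           (x≤y⇒0≤y-x (≤-√ [s+e]²≤x)))

    √²≈ : s ² ≈ x
    √²≈ = ≤-antisym √²≤ ≤√²

  module _ {I : Set} {F : I → Carrier} (i₀ : I) {b : Carrier} (F≤b : ∀ i → F i ≤ b) where

    private
      ⨆-lub : IsLeastUpperBound (λ x → Σ[ i ∈ I ] x ≈ F i) (⨆ F)
      ⨆-lub = sup-isLeastUpperBound _ (F i₀ , i₀ , refl) (b , λ { x (i , x≈Fi) → ≤-respˡ (sym x≈Fi) (F≤b i) })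

    ≤-⨆ : ∀ i → F i ≤ ⨆ F
    ≤-⨆ i = proj₁ ⨆-lub (F i) (i , refl)

    -- The bound fixed by the enclosing module only certifies that the supremum is meaningful; the
    -- `b` quantified here shadows it and is the bound to be proved.
    ⨆-least : ∀ {b} → (∀ i → F i ≤ b) → ⨆ F ≤ b
    ⨆-least {b} F≤b = proj₂ ⨆-lub b λ { x (i , x≈Fi) → ≤-respˡ (sym x≈Fi) (F≤b i) }

-- Finite sums, indicators and maxima.

module FiniteSums (ℝ : CompleteOrderedField) where

  open CompleteOrderedField ℝ hiding (zero)
  open OrderedFieldProperties ℝ
  private module Sum = SemiringSum semiring

  -- The number of summands is explicit in these lemmas: it cannot be inferred,
  -- because a sum unfolds to a fold that is stuck on it.
  ∑-comm : ∀ m n (f : Fin m → Fin n → Carrier) →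
           ∑[ i < m ] ∑[ j < n ] f i j ≈ ∑[ j < n ] ∑[ i < m ] f i j
  ∑-comm m n = Sum.∑-comm

  ∑-distrib-+ : ∀ n (f g : Fin n → Carrier) → ∑[ i < n ] (f i + g i) ≈ ∑[ i < n ] f i + ∑[ i < n ] g i
  ∑-distrib-+ n = Sum.∑-distrib-+

  ∑-cong : ∀ n {f g : Fin n → Carrier} → (∀ i → f i ≈ g i) → ∑[ i < n ] f i ≈ ∑[ i < n ] g i
  ∑-cong n = Sum.sum-cong-≋

  ∑-mono : ∀ n {f g : Fin n → Carrier} → (∀ i → f i ≤ g i) → ∑[ i < n ] f i ≤ ∑[ i < n ] g i
  ∑-mono zero    f≤g = ≤-refl
  ∑-mono (suc n) f≤g = +-mono-≤ (f≤g zero) (∑-mono n λ i → f≤g (suc i))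

  ∑-zero : ∀ n {f : Fin n → Carrier} → (∀ i → f i ≈ 0#) → ∑[ i < n ] f i ≈ 0#
  ∑-zero n f≈0 = trans (∑-cong n f≈0) (Sum.sum-replicate-zero n)

  ∑-nonNegative : ∀ n {f : Fin n → Carrier} → (∀ i → 0# ≤ f i) → 0# ≤ ∑[ i < n ] f i
  ∑-nonNegative zero    0≤f = ≤-refl
  ∑-nonNegative (suc n) 0≤f = +-nonNegative (0≤f zero) (∑-nonNegative n λ i → 0≤f (suc i))

  term≤∑ : ∀ n {f : Fin n → Carrier} → (∀ i → 0# ≤ f i) → ∀ i → f i ≤ ∑[ j < n ] f j
  term≤∑ (suc n) 0≤f zero    = ≤-respˡ (+-identityʳ _) (+-monoʳ-≤ _ (∑-nonNegative n λ i → 0≤f (suc i)))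
  term≤∑ (suc n) 0≤f (suc i) = ≤-respˡ (+-identityˡ _) (+-mono-≤ (0≤f zero) (term≤∑ n (λ j → 0≤f (suc j)) i))

  *-distribˡ-∑ : ∀ n x (f : Fin n → Carrier) → x * (∑[ i < n ] f i) ≈ ∑[ i < n ] (x * f i)
  *-distribˡ-∑ n = Sum.*-distribˡ-sum

  *-distribʳ-∑ : ∀ n (f : Fin n → Carrier) x → (∑[ i < n ] f i) * x ≈ ∑[ i < n ] (f i * x)
  *-distribʳ-∑ n f x = Sum.*-distribʳ-sum x f

  ∑*∑ : ∀ m n (f : Fin m → Carrier) (g : Fin n → Carrier) →
        (∑[ i < m ] f i) * (∑[ j < n ] g j) ≈ ∑[ i < m ] ∑[ j < n ] (f i * g j)
  ∑*∑ m n f g = trans (*-distribʳ-∑ m f _) (∑-cong m λ i → *-distribˡ-∑ n (f i) g)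

  ∑-distrib-minus : ∀ n (f g : Fin n → Carrier) → ∑[ i < n ] (f i - g i) ≈ ∑[ i < n ] f i - ∑[ i < n ] g i
  ∑-distrib-minus zero    f g = sym (-‿inverseʳ 0#)
  ∑-distrib-minus (suc n) f g = trans (+-congˡ (∑-distrib-minus n (λ i → f (suc i)) (λ i → g (suc i))))
    (solve 4 (λ a b c d → (a :- b) :+ (c :- d) := (a :+ c) :- (b :+ d)) refl _ _ _ _)

  ∑∑-cong : ∀ m n {f g : Fin m → Fin n → Carrier} → (∀ i j → f i j ≈ g i j) →
            ∑[ i < m ] ∑[ j < n ] f i j ≈ ∑[ i < m ] ∑[ j < n ] g i j
  ∑∑-cong m n f≈g = ∑-cong m λ i → ∑-cong n λ j → f≈g i j

  ∑∑-mono : ∀ m n {f g : Fin m → Fin n → Carrier} → (∀ i j → f i j ≤ g i j) →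
            ∑[ i < m ] ∑[ j < n ] f i j ≤ ∑[ i < m ] ∑[ j < n ] g i j
  ∑∑-mono m n f≤g = ∑-mono m λ i → ∑-mono n λ j → f≤g i j

  ∑∑-distrib-+ : ∀ m n (f g : Fin m → Fin n → Carrier) → ∑[ i < m ] ∑[ j < n ] (f i j + g i j) ≈
                 ∑[ i < m ] ∑[ j < n ] f i j + ∑[ i < m ] ∑[ j < n ] g i j
  ∑∑-distrib-+ m n f g = trans (∑-cong m λ i → ∑-distrib-+ n (f i) (g i)) (∑-distrib-+ m _ _)

  ∑-∑∑-comm : ∀ k m n (f : Fin k → Fin m → Fin n → Carrier) →
              ∑[ h < k ] ∑[ i < m ] ∑[ j < n ] f h i j ≈ ∑[ i < m ] ∑[ j < n ] ∑[ h < k ] f h i j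
  ∑-∑∑-comm k m n f = trans (∑-comm k m _) (∑-cong m λ i → ∑-comm k n _)

  *-distribˡ-∑∑ : ∀ m n x (f : Fin m → Fin n → Carrier) →
                  x * (∑[ i < m ] ∑[ j < n ] f i j) ≈ ∑[ i < m ] ∑[ j < n ] (x * f i j)
  *-distribˡ-∑∑ m n x f = trans (*-distribˡ-∑ m x _) (∑-cong m λ i → *-distribˡ-∑ n x _)

  *-distribʳ-∑∑ : ∀ m n (f : Fin m → Fin n → Carrier) x →
                  (∑[ i < m ] ∑[ j < n ] f i j) * x ≈ ∑[ i < m ] ∑[ j < n ] (f i j * x)
  *-distribʳ-∑∑ m n f x = trans (*-distribʳ-∑ m _ x) (∑-cong m λ i → *-distribʳ-∑ n _ x)

  indicator-nonNegative : ∀ b → 0# ≤ indicator b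
  indicator-nonNegative true  = 0≤1
  indicator-nonNegative false = ≤-refl

  indicator≤1 : ∀ b → indicator b ≤ 1#
  indicator≤1 true  = ≤-refl
  indicator≤1 false = 0≤1

  indicator-suc : ∀ {n} (i j : Fin n) → indicator ⌊ suc i Fin.≟ suc j ⌋ ≈ indicator ⌊ i Fin.≟ j ⌋
  indicator-suc i j with i Fin.≟ j
  ... | yes _ = refl
  ... | no  _ = refl

  ∑-indicator : ∀ {n} (i : Fin n) (f : Fin n → Carrier) → ∑[ j < n ] (indicator ⌊ i Fin.≟ j ⌋ * f j) ≈ f i
  ∑-indicator zero    f = trans (+-cong (*-identityˡ _) (∑-zero _ λ j → zeroˡ (f (suc j)))) (+-identityʳ _)
  ∑-indicator (suc i) f = trans (+-cong (zeroˡ _) (trans (∑-cong _ λ j → *-congʳ (indicator-suc i j))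
                            (∑-indicator i λ j → f (suc j)))) (+-identityˡ _)

  ∑-indicator≤1 : ∀ {n} (P : Fin n → Bool) → (∀ {i j} → T (P i) → T (P j) → i ≡ j) →
                  ∑[ i < n ] indicator (P i) ≤ 1#
  ∑-indicator≤1 {zero}  P unique = 0≤1
  ∑-indicator≤1 {suc n} P unique with P zero in P0
  ... | false = ≤-respˡ (sym (+-identityˡ _)) (∑-indicator≤1 (λ i → P (suc i)) λ p q → Fin.suc-injective (unique p q))
  ... | true  = ≤-reflexive (trans (+-congˡ (∑-zero n rest)) (+-identityʳ 1#))
    where
    rest : ∀ i → indicator (P (suc i)) ≈ 0#
    rest i with P (suc i) in Pi
    ... | false = refl
    ... | true with () ← unique {zero} {suc i} (≡.subst T (≡.sym P0) _) (≡.subst T (≡.sym Pi) _)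

  maximum : ∀ {n} → Fin n → (f : Fin n → Carrier) → ∃ λ i → ∀ j → f j ≤ f i
  maximum {suc zero}    _ f = zero , λ { zero → ≤-refl }
  maximum {suc (suc n)} _ f with maximum {suc n} zero (λ i → f (suc i))
  ... | i , f≤fi with ≤-total (f zero) (f (suc i))
  ...   | inj₁ f0≤fi = suc i , λ { zero → f0≤fi ; (suc j) → f≤fi j }
  ...   | inj₂ fi≤f0 = zero , λ { zero → ≤-refl ; (suc j) → ≤-trans (f≤fi j) fi≤f0 }

  -- The cap `μ ≤ 1#` allows `μ` to serve as a geometric rate; it also supplies the value for the
  -- empty family.
  positive-lowerBound : ∀ {n} (f : Fin n → Carrier) → (∀ i → 0# < f i) →
                        ∃ λ μ → 0# < μ × μ ≤ 1# × (∀ i → μ ≤ f i)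
  positive-lowerBound {zero}  f 0<f = 1# , 0<1 , ≤-refl , λ ()
  positive-lowerBound {suc n} f 0<f with positive-lowerBound (λ i → f (suc i)) (λ i → 0<f (suc i))
  ... | μ , 0<μ , μ≤1 , μ≤f with ≤-total μ (f zero)
  ...   | inj₁ μ≤f0 = μ , 0<μ , μ≤1 , λ { zero → μ≤f0 ; (suc i) → μ≤f i }
  ...   | inj₂ f0≤μ = f zero , 0<f zero , ≤-trans f0≤μ μ≤1 , λ { zero → ≤-refl ; (suc i) → ≤-trans f0≤μ (μ≤f i) }

  convexCombination≤ : ∀ n (p f : Fin n → Carrier) {b} → (∀ i → 0# ≤ p i) → ∑[ i < n ] p i ≈ 1# → (∀ i → f i ≤ b) →
                       ∑[ i < n ] (p i * f i) ≤ b
  convexCombination≤ n p f {b} 0≤p ∑p≈1 f≤b = ≤-respʳ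
    (trans (sym (*-distribʳ-∑ n p b)) (trans (*-congʳ ∑p≈1) (*-identityˡ b)))
    (∑-mono n λ i → *-monoˡ-≤ (0≤p i) (f≤b i))

-- Geometric convergence to 1.

module GeometricApproach (ℝ : CompleteOrderedField) where

  open CompleteOrderedField ℝ hiding (zero)
  open OrderedFieldProperties ℝ

  -- This is `1 - (1 - μ)ⁿ`, given by its recurrence: each step closes the fraction `μ` of the
  -- remaining gap to 1.
  approach : Carrier → ℕ → Carrier
  approach μ zero    = 0#
  approach μ (suc n) = approach μ n + μ * (1# - approach μ n)

  module _ {μ} (0<μ : 0# < μ) (μ≤1 : μ ≤ 1#) where

    approach≤1 : ∀ n → approach μ n ≤ 1#
    approach≤1 zero    = 0≤1
    approach≤1 (suc n) = ≤-from-difference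
      (solve 2 (λ m a → con (+ 1) :- (a :+ m :* (con (+ 1) :- a)) := (con (+ 1) :- m) :* (con (+ 1) :- a)) refl μ (approach μ n))
      (*-nonNegative (x≤y⇒0≤y-x μ≤1) (x≤y⇒0≤y-x (approach≤1 n)))

    -- Completeness replaces an estimate of `(1 - μ)ⁿ`. The bounds by the supremum `s` at `n` and at
    -- `suc n` combine to bound the value at `n` by `s - μ (x - s)`. This is then an upper bound
    -- too, and leastness of `s` forces `x ≤ s`.
    ≤-limit : ∀ {x c} → (∀ n → x * approach μ n ≤ c) → x ≤ c
    ≤-limit {x} {c} xa≤c = ≤-trans x≤s (⨆-least zero xa≤c xa≤c)
      where
      s : Carrier
      s = ⨆ (λ n → x * approach μ n)

      xa≤s : ∀ n → x * approach μ n ≤ s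
      xa≤s = ≤-⨆ zero xa≤c

      xa≤s-μ[x-s] : ∀ n → x * approach μ n ≤ s - μ * (x - s)
      xa≤s-μ[x-s] n = ≤-from-difference
        (solve 4 (λ s m x a → s :- m :* (x :- s) :- x :* a
                    := (s :- x :* (a :+ m :* (con (+ 1) :- a))) :+ m :* (s :- x :* a)) refl s μ x (approach μ n))
        (+-nonNegative (x≤y⇒0≤y-x (xa≤s (suc n))) (*-nonNegative (proj₁ 0<μ) (x≤y⇒0≤y-x (xa≤s n))))

      x≤s : x ≤ s
      x≤s = *-cancelˡ-≤ 0<μ (≤-from-difference
        (solve 3 (λ s m x → m :* s :- m :* x := (s :- m :* (x :- s)) :- s) refl s μ x)
        (x≤y⇒0≤y-x (⨆-least zero xa≤c xa≤s-μ[x-s])))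

-- Layer-cake decomposition of a nonnegative function on a finite set.

module LayerCakes (ℝ : CompleteOrderedField) where

  open CompleteOrderedField ℝ hiding (zero)
  open OrderedFieldProperties ℝ
  open FiniteSums ℝ
  open Sort decTotalOrder using (sort; sort-↭; sort-↗)

  indicator-≤ : ∀ {x y} → x ≤ y → indicator ⌊ x ≤? y ⌋ ≈ 1#
  indicator-≤ {x} {y} x≤y with x ≤? y
  ... | yes _   = refl
  ... | no  x≰y = contradiction x≤y x≰y

  -- The heights will be the gaps between consecutive entries of a sorted list that starts at
  -- `base`, so the layers reached by a member telescope. `below-base` closes the induction: at a
  -- newly added entry the layers above it contribute nothing.
  record Layers (base : Carrier) (zs : List Carrier) : Set where
    field
      count              : ℕ
      height             : Fin count → Carrier
      threshold          : Fin count → Carrier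
      height-nonNegative : ∀ j → 0# ≤ height j

    heightBelow : Carrier → Carrier
    heightBelow z = ∑[ j < count ] (height j * indicator ⌊ threshold j ≤? z ⌋)

    field
      below-base : ∀ {z} → z ≤ base → heightBelow z ≈ 0#
      at-member  : ∀ {z} → z ∈ zs → heightBelow z ≈ z - base

  layers : ∀ {base zs} → AllPairs _≤_ (base ∷ zs) → Layers base zs
  layers {base} {[]} _ = record
    { count = 0 ; height = λ () ; threshold = λ () ; height-nonNegative = λ ()
    ; below-base = λ _ → refl ; at-member = λ () }
  layers {base} {t ∷ zs} ((base≤t All.∷ _) ∷ t∷zs-sorted@(t≤zs ∷ _)) = record
    { count              = suc count
    ; height             = λ { zero → t - base ; (suc j) → height j }
    ; threshold          = λ { zero → t ; (suc j) → threshold j }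
    ; height-nonNegative = λ { zero → x≤y⇒0≤y-x base≤t ; (suc j) → height-nonNegative j }
    ; below-base         = λ z≤base → trans (+-cong (lowest z≤base) (below-base (≤-trans z≤base base≤t))) (+-identityˡ 0#)
    ; at-member          = at
    }
    where
    open Layers (layers t∷zs-sorted)

    lowest : ∀ {z} → z ≤ base → (t - base) * indicator ⌊ t ≤? z ⌋ ≈ 0#
    lowest {z} z≤base with t ≤? z
    -- Here `t ≤ z ≤ base ≤ t`, so `t` repeats `base` and its layer has height 0.
    ... | yes t≤z = trans (*-congʳ (trans (+-congʳ (≤-antisym (≤-trans t≤z z≤base) base≤t)) (-‿inverseʳ base))) (zeroˡ _)
    ... | no  _   = zeroʳ _

    at : ∀ {z} → z ∈ t ∷ zs → (t - base) * indicator ⌊ t ≤? z ⌋ + heightBelow z ≈ z - base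
    at (here ≡.refl) = trans (+-cong (trans (*-congˡ (indicator-≤ ≤-refl)) (*-identityʳ _)) (below-base ≤-refl)) (+-identityʳ _)
    at {z} (there z∈zs) = trans
      (+-cong (trans (*-congˡ (indicator-≤ (All.lookup t≤zs z∈zs))) (*-identityʳ _)) (at-member z∈zs))
      (solve 3 (λ t b z → (t :- b) :+ (z :- t) := z :- b) refl t base z)

  module LayerCake {n} (y : Fin n → Carrier) (0≤y : ∀ i → 0# ≤ y i) where

    private
      zs : List Carrier
      zs = sort (tabulate y)

      0≤zs : All (0# ≤_) zs
      0≤zs = All.tabulate λ z∈zs → let (i , z≡yi) = ∈-tabulate⁻ (∈-resp-↭ (sort-↭ _) z∈zs) in
        ≡.subst (0# ≤_) (≡.sym z≡yi) (0≤y i)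

      cake : Layers 0# zs
      cake = layers (0≤zs ∷ Linked⇒AllPairs ≤-trans (sort-↗ (tabulate y)))

    open Layers cake public using (count; height; height-nonNegative)
    open Layers cake using (threshold; at-member)

    inLayer : Fin count → Fin n → Bool
    inLayer j i = ⌊ threshold j ≤? y i ⌋

    ∑-layers : ∀ i → ∑[ j < count ] (height j * indicator (inLayer j i)) ≈ y i
    ∑-layers i = trans (at-member (∈-resp-↭ (↭-sym (sort-↭ _)) (∈-tabulate⁺ i)))
      (solve 1 (λ y → y :- con (+ 0) := y) refl (y i))

    -- Layers are upper level sets, hence nested: a layer containing `i` contains every index with a
    -- larger value.
    inLayer-* : ∀ {i k} → y i ≤ y k → ∀ j →
                indicator (inLayer j i) * indicator (inLayer j k) ≈ indicator (inLayer j i)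
    inLayer-* {i} {k} yi≤yk j with threshold j ≤? y i
    ... | yes t≤yi = trans (*-identityˡ _) (indicator-≤ (≤-trans t≤yi yi≤yk))
    ... | no  _    = zeroˡ _

    -- By nestedness this is the minimum of `y i` and `y k`.
    common : Fin n → Fin n → Carrier
    common i k = ∑[ j < count ] (height j * (indicator (inLayer j i) * indicator (inLayer j k)))

    common-≤ : ∀ {i k} → y i ≤ y k → common i k ≈ y i
    common-≤ {i} yi≤yk = trans (∑-cong count λ j → *-congˡ (inLayer-* yi≤yk j)) (∑-layers i)

    common-≥ : ∀ {i k} → y k ≤ y i → common i k ≈ y k
    common-≥ {i} {k} yk≤yi = trans (∑-cong count λ j → *-congˡ (trans (*-comm _ _) (inLayer-* yk≤yi j))) (∑-layers k)

-- Expectations as normalised positive linear functionals.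

module Expectations (ℝ : CompleteOrderedField) where

  open CompleteOrderedField ℝ hiding (zero)
  open OrderedFieldProperties ℝ
  open FiniteSums ℝ

  -- The draws averaged later form a dependent sum, with a different number of layers over each `ω`.
  -- An axiomatic average avoids enumerating them.
  record Expectation (J : Set) : Set where
    field
      𝔼        : (J → Carrier) → Carrier
      𝔼-mono   : ∀ {F H} → (∀ j → F j ≤ H j) → 𝔼 F ≤ 𝔼 H
      𝔼-homo-+ : ∀ F H → 𝔼 (λ j → F j + H j) ≈ 𝔼 F + 𝔼 H
      𝔼-homo-* : ∀ c F → 𝔼 (λ j → c * F j) ≈ c * 𝔼 F
      𝔼-1      : 𝔼 (λ _ → 1#) ≈ 1#

    𝔼-cong : ∀ {F H} → (∀ j → F j ≈ H j) → 𝔼 F ≈ 𝔼 H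
    𝔼-cong F≈H = ≤-antisym (𝔼-mono λ j → ≤-reflexive (F≈H j)) (𝔼-mono λ j → ≤-reflexive (sym (F≈H j)))

    𝔼-const : ∀ c → 𝔼 (λ _ → c) ≈ c
    𝔼-const c = trans (𝔼-cong λ _ → sym (*-identityʳ c)) (trans (𝔼-homo-* c (λ _ → 1#)) (trans (*-congˡ 𝔼-1) (*-identityʳ c)))

    𝔼-nonNegative : ∀ {F} → (∀ j → 0# ≤ F j) → 0# ≤ 𝔼 F
    𝔼-nonNegative 0≤F = ≤-respˡ (𝔼-const 0#) (𝔼-mono 0≤F)

    𝔼-∑ : ∀ {n} (F : Fin n → J → Carrier) → 𝔼 (λ j → ∑[ i < n ] F i j) ≈ ∑[ i < n ] 𝔼 (F i)
    𝔼-∑ {zero}  F = 𝔼-const 0#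
    𝔼-∑ {suc n} F = trans (𝔼-homo-+ (F zero) _) (+-congˡ (𝔼-∑ λ i → F (suc i)))

-- The squared norm as a quadratic form over pairs of edges, and partial assignments.

module CollisionForm (ℝ : CompleteOrderedField) (G : ProjectionGames.ProjectionGame ℝ) where

  open CompleteOrderedField ℝ hiding (zero)
  open OrderedFieldProperties ℝ
  open FiniteSums ℝ
  open ProjectionGames ℝ
  open ProjectionGame G
  open SetoidReasoning setoid

  probability-nonNegative : ∀ e → 0# ≤ probability e
  probability-nonNegative e = /-nonNegative (weight-nonNegative e) totalWeight-positive

  ∑-probability : ∑[ e < |E| ] probability e ≈ 1#
  ∑-probability = trans (sym (*-distribʳ-∑ |E| weight (totalWeight ⁻¹))) (⁻¹-inverseʳ (0<⇒≉0 totalWeight-positive))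

  conditional-nonNegative : ∀ u e → 0# ≤ conditional u e
  conditional-nonNegative u e = /-nonNegative
    (*-nonNegative (indicator-nonNegative _) (probability-nonNegative e)) (measureU-positive u)

  ∑-conditional : ∀ u → ∑[ e < |E| ] conditional u e ≈ 1#
  ∑-conditional u = trans (sym (*-distribʳ-∑ |E| _ (measureU u ⁻¹))) (⁻¹-inverseʳ (0<⇒≉0 (measureU-positive u)))

  measureU*conditional : ∀ u e → measureU u * conditional u e ≈ indicator ⌊ left e Fin.≟ u ⌋ * probability e
  measureU*conditional u e = trans (*-comm _ _) (/-cancelʳ (0<⇒≉0 (measureU-positive u)))

  ∑-measureU : ∑[ u < |U| ] measureU u ≈ 1#
  ∑-measureU = begin
    ∑[ u < |U| ] ∑[ e < |E| ] (indicator ⌊ left e Fin.≟ u ⌋ * probability e)  ≈⟨ ∑-comm |U| |E| _ ⟩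
    ∑[ e < |E| ] ∑[ u < |U| ] (indicator ⌊ left e Fin.≟ u ⌋ * probability e)  ≈⟨ ∑-cong |E| (λ e → ∑-indicator (left e) (λ _ → probability e)) ⟩
    ∑[ e < |E| ] probability e                                                ≈⟨ ∑-probability ⟩
    1#                                                                        ∎

  push : Edge → (V → Alphabet → Carrier) → Alphabet → Carrier
  push e g α = ∑[ β < |Σ| ] (indicator (constraint e α β) * g (right e) β)

  -- For an assignment `g`, the probability that letters drawn independently from `g` at the two
  -- right ends are projected to a common letter.
  collision : Edge → Edge → (V → Alphabet → Carrier) → Carrier
  collision e e′ g = ∑[ α < |Σ| ] (push e g α * push e′ g α)

  form : (Edge → Edge → Carrier) → (V → Alphabet → Carrier) → Carrier
  form w g = ∑[ e < |E| ] ∑[ e′ < |E| ] (w e e′ * collision e e′ g)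

  -- The law of two edges drawn independently, conditioned on a common left endpoint that is itself
  -- drawn from `measureU`.
  pairWeight : Edge → Edge → Carrier
  pairWeight e e′ = ∑[ u < |U| ] (measureU u * (conditional u e * conditional u e′))

  pairWeight-nonNegative : ∀ e e′ → 0# ≤ pairWeight e e′
  pairWeight-nonNegative e e′ = ∑-nonNegative |U| λ u → *-nonNegative (proj₁ (measureU-positive u))
    (*-nonNegative (conditional-nonNegative u e) (conditional-nonNegative u e′))

  normSquared-operator : ∀ g → normSquared G (operator G g) ≈ form pairWeight g
  normSquared-operator g = begin
    ∑[ u < |U| ] (measureU u * (∑[ α < |Σ| ] (operator G g u α ²)))
      ≈⟨ ∑-cong |U| (λ u → *-congˡ (perVertex u)) ⟩
    ∑[ u < |U| ] (measureU u * (∑[ e < |E| ] ∑[ e′ < |E| ] (conditional u e * conditional u e′ * collision e e′ g)))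
      ≈⟨ ∑-cong |U| (λ u → trans (*-distribˡ-∑∑ |E| |E| _ _) (∑∑-cong |E| |E| λ e e′ → sym (*-assoc _ _ _))) ⟩
    ∑[ u < |U| ] ∑[ e < |E| ] ∑[ e′ < |E| ] (measureU u * (conditional u e * conditional u e′) * collision e e′ g)
      ≈⟨ ∑-∑∑-comm |U| |E| |E| _ ⟩
    ∑[ e < |E| ] ∑[ e′ < |E| ] ∑[ u < |U| ] (measureU u * (conditional u e * conditional u e′) * collision e e′ g)
      ≈⟨ ∑∑-cong |E| |E| (λ e e′ → sym (*-distribʳ-∑ |U| _ _)) ⟩
    form pairWeight g ∎
    where
    perVertex : ∀ u → ∑[ α < |Σ| ] (operator G g u α ²) ≈
                ∑[ e < |E| ] ∑[ e′ < |E| ] (conditional u e * conditional u e′ * collision e e′ g)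
    perVertex u = begin
      ∑[ α < |Σ| ] (operator G g u α ²)
        ≈⟨ ∑-cong |Σ| (λ α → ∑*∑ |E| |E| _ _) ⟩
      ∑[ α < |Σ| ] ∑[ e < |E| ] ∑[ e′ < |E| ] (conditional u e * push e g α * (conditional u e′ * push e′ g α))
        ≈⟨ ∑-∑∑-comm |Σ| |E| |E| _ ⟩
      ∑[ e < |E| ] ∑[ e′ < |E| ] ∑[ α < |Σ| ] (conditional u e * push e g α * (conditional u e′ * push e′ g α))
        ≈⟨ ∑∑-cong |E| |E| (λ e e′ → trans (∑-cong |Σ| λ α → solve 4 (λ a b c d → a :* b :* (c :* d) := a :* c :* (b :* d)) refl _ _ _ _)
             (sym (*-distribˡ-∑ |Σ| _ _))) ⟩
      ∑[ e < |E| ] ∑[ e′ < |E| ] (conditional u e * conditional u e′ * collision e e′ g) ∎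

  ∑∑-pairWeight : ∑[ e < |E| ] ∑[ e′ < |E| ] pairWeight e e′ ≈ 1#
  ∑∑-pairWeight = begin
    ∑[ e < |E| ] ∑[ e′ < |E| ] pairWeight e e′
      ≈⟨ ∑-∑∑-comm |U| |E| |E| _ ⟨
    ∑[ u < |U| ] ∑[ e < |E| ] ∑[ e′ < |E| ] (measureU u * (conditional u e * conditional u e′))
      ≈⟨ ∑-cong |U| (λ u → trans (sym (*-distribˡ-∑∑ |E| |E| _ _)) (*-congˡ (sym (∑*∑ |E| |E| _ _)))) ⟩
    ∑[ u < |U| ] (measureU u * ((∑[ e < |E| ] conditional u e) * (∑[ e < |E| ] conditional u e)))
      ≈⟨ ∑-cong |U| (λ u → trans (*-congˡ (trans (*-cong (∑-conditional u) (∑-conditional u)) (*-identityˡ 1#))) (*-identityʳ _)) ⟩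
    ∑[ u < |U| ] measureU u
      ≈⟨ ∑-measureU ⟩
    1# ∎

  push-nonNegative : ∀ {g} → (∀ v β → 0# ≤ g v β) → ∀ e α → 0# ≤ push e g α
  push-nonNegative 0≤g e α = ∑-nonNegative |Σ| λ β → *-nonNegative (indicator-nonNegative _) (0≤g _ β)

  collision-nonNegative : ∀ {g} → (∀ v β → 0# ≤ g v β) → ∀ e e′ → 0# ≤ collision e e′ g
  collision-nonNegative 0≤g e e′ = ∑-nonNegative |Σ| λ α →
    *-nonNegative (push-nonNegative 0≤g e α) (push-nonNegative 0≤g e′ α)

  module _ {g} (g-assignment : IsAssignment G g) where

    open IsAssignment g-assignment

    -- The projection property enters here: each letter `β` is counted for at most one `α`.
    ∑-push≤1 : ∀ e → ∑[ α < |Σ| ] push e g α ≤ 1#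
    ∑-push≤1 e = ≤-respˡ (sym (∑-comm |Σ| |Σ| _)) (≤-trans (∑-mono |Σ| column) (≤-reflexive (normalised (right e))))
      where
      column : ∀ β → ∑[ α < |Σ| ] (indicator (constraint e α β) * g (right e) β) ≤ g (right e) β
      column β = ≤-respˡ (*-distribʳ-∑ |Σ| _ _) (≤-respʳ (*-identityˡ _) (*-monoʳ-≤ (nonNegative _ β)
        (∑-indicator≤1 (λ α → constraint e α β) (projection e β))))

    push≤1 : ∀ e α → push e g α ≤ 1#
    push≤1 e α = ≤-trans (term≤∑ |Σ| (push-nonNegative nonNegative e) α) (∑-push≤1 e)

    collision≤1 : ∀ e e′ → collision e e′ g ≤ 1#
    collision≤1 e e′ = ≤-trans
      (∑-mono |Σ| λ α → ≤-respʳ (*-identityʳ _) (*-monoˡ-≤ (push-nonNegative nonNegative e α) (push≤1 e′ α)))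
      (∑-push≤1 e)

    form-nonNegative : ∀ {w} → (∀ e e′ → 0# ≤ w e e′) → 0# ≤ form w g
    form-nonNegative 0≤w = ∑-nonNegative |E| λ e → ∑-nonNegative |E| λ e′ →
      *-nonNegative (0≤w e e′) (collision-nonNegative nonNegative e e′)

  push-linear : ∀ (x y : V → Carrier) f g e α →
                push e (λ v β → x v * f v β + y v * g v β) α ≈ x (right e) * push e f α + y (right e) * push e g α
  push-linear x y f g e α = begin
    push e (λ v β → x v * f v β + y v * g v β) α
      ≈⟨ ∑-cong |Σ| (λ β → solve 5 (λ i a b c d → i :* (a :* b :+ c :* d) := a :* (i :* b) :+ c :* (i :* d)) refl _ _ _ _ _) ⟩
    ∑[ β < |Σ| ] (x (right e) * (indicator (constraint e α β) * f (right e) β) + y (right e) * (indicator (constraint e α β) * g (right e) β))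
      ≈⟨ ∑-distrib-+ |Σ| _ _ ⟩
    ∑[ β < |Σ| ] (x (right e) * (indicator (constraint e α β) * f (right e) β)) + ∑[ β < |Σ| ] (y (right e) * (indicator (constraint e α β) * g (right e) β))
      ≈⟨ +-cong (*-distribˡ-∑ |Σ| _ _) (*-distribˡ-∑ |Σ| _ _) ⟨
    x (right e) * push e f α + y (right e) * push e g α ∎

  -- `value` is total and fractional, and `domain` alone says where it counts; overriding thus
  -- becomes a pointwise combination with 0/1 coefficients.
  record PartialAssignment : Set where
    field
      domain       : V → Bool
      value        : V → Alphabet → Carrier
      isAssignment : IsAssignment G value

    inside outside : V → Carrier
    inside v  = indicator (domain v)
    outside v = 1# - inside v

    inside-nonNegative : ∀ v → 0# ≤ inside v
    inside-nonNegative v = indicator-nonNegative (domain v)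

    outside-nonNegative : ∀ v → 0# ≤ outside v
    outside-nonNegative v = x≤y⇒0≤y-x (indicator≤1 (domain v))

    override : (V → Alphabet → Carrier) → (V → Alphabet → Carrier)
    override g v β = inside v * value v β + outside v * g v β

    override-isAssignment : ∀ {g} → IsAssignment G g → IsAssignment G (override g)
    override-isAssignment {g} g-assignment = record
      { nonNegative = λ v β → +-nonNegative (*-nonNegative (inside-nonNegative v) (p.nonNegative v β))
                                            (*-nonNegative (outside-nonNegative v) (g.nonNegative v β))
      ; normalised = λ v → begin
          ∑[ β < |Σ| ] (inside v * value v β + outside v * g v β)
            ≈⟨ trans (∑-distrib-+ |Σ| _ _) (sym (+-cong (*-distribˡ-∑ |Σ| _ _) (*-distribˡ-∑ |Σ| _ _))) ⟩
          inside v * (∑[ β < |Σ| ] value v β) + outside v * (∑[ β < |Σ| ] g v β)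
            ≈⟨ +-cong (*-congˡ (p.normalised v)) (*-congˡ (g.normalised v)) ⟩
          inside v * 1# + outside v * 1#
            ≈⟨ solve 1 (λ i → i :* con (+ 1) :+ (con (+ 1) :- i) :* con (+ 1) := con (+ 1)) refl (inside v) ⟩
          1# ∎
      }
      where
      module p = IsAssignment isAssignment
      module g = IsAssignment g-assignment

    agreeing excluded : Edge → Edge → Carrier
    agreeing e e′ = inside (right e) * inside (right e′) * collision e e′ value
    excluded e e′ = outside (right e) * outside (right e′)

    -- The product of the two pushes splits into four terms according to which ends lie in the
    -- domain; the two mixed terms are nonnegative and are dropped.
    collision-override : ∀ {g} → IsAssignment G g → ∀ e e′ →
                         agreeing e e′ + excluded e e′ * collision e e′ g ≤ collision e e′ (override g)
    collision-override {g} g-assignment e e′ = ≤-respˡ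
      (sym (trans (+-cong (*-distribˡ-∑ |Σ| _ _) (*-distribˡ-∑ |Σ| _ _)) (sym (∑-distrib-+ |Σ| _ _))))
      (∑-mono |Σ| λ α → ≤-respʳ (*-cong (sym (push-linear inside outside value g e α)) (sym (push-linear inside outside value g e′ α)))
        (≤-from-difference
          (solve 8 (λ i o i′ o′ x y x′ y′ → (i :* x :+ o :* y) :* (i′ :* x′ :+ o′ :* y′) :- (i :* i′ :* (x :* x′) :+ o :* o′ :* (y :* y′))
                       := i :* x :* (o′ :* y′) :+ o :* y :* (i′ :* x′)) refl _ _ _ _ _ _ _ _)
          (+-nonNegative
            (*-nonNegative (*-nonNegative (inside-nonNegative _) (push-nonNegative p.nonNegative e α))
                           (*-nonNegative (outside-nonNegative _) (push-nonNegative g.nonNegative e′ α)))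
            (*-nonNegative (*-nonNegative (outside-nonNegative _) (push-nonNegative g.nonNegative e α))
                           (*-nonNegative (inside-nonNegative _) (push-nonNegative p.nonNegative e′ α))))))
      where
      module p = IsAssignment isAssignment
      module g = IsAssignment g-assignment

-- Correlated sampling.

module CorrelatedSampling (ℝ : CompleteOrderedField) (G : ProjectionGames.ProjectionGame ℝ) where

  open CompleteOrderedField ℝ hiding (zero)
  open OrderedFieldProperties ℝ
  open FiniteSums ℝ
  open GeometricApproach ℝ
  open Expectations ℝ
  open ProjectionGames ℝ
  open ProjectionGame G
  open CollisionForm ℝ G

  someLetter : Alphabet
  someLetter = letter Σ-nonEmpty
    where
    letter : ∀ {n} → NonZero n → Fin n
    letter {suc n} _ = zero

  deterministic : (V → Alphabet) → V → Alphabet → Carrier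
  deterministic b v β = indicator ⌊ b v Fin.≟ β ⌋

  deterministic-isAssignment : ∀ b → IsAssignment G (deterministic b)
  deterministic-isAssignment b = record
    { nonNegative = λ v β → indicator-nonNegative _
    ; normalised  = λ v → trans (∑-cong |Σ| λ β → sym (*-identityʳ _)) (∑-indicator (b v) (λ _ → 1#))
    }

  IsFormBound : (Edge → Edge → Carrier) → Carrier → Set
  IsFormBound w c = ∀ g → IsAssignment G g → form w g ≤ c

  module _ {J} (expectation : Expectation J) (X : J → PartialAssignment) where

    open Expectation expectation
    open PartialAssignment

    agree neither : Edge → Edge → Carrier
    agree   e e′ = 𝔼 (λ j → agreeing (X j) e e′)
    neither e e′ = 𝔼 (λ j → excluded (X j) e e′)

    neither-nonNegative : ∀ e e′ → 0# ≤ neither e e′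
    neither-nonNegative e e′ = 𝔼-nonNegative λ j →
      *-nonNegative (outside-nonNegative (X j) _) (outside-nonNegative (X j) _)

    module _ {w c} (0≤w : ∀ e e′ → 0# ≤ w e e′) (w-bound : IsFormBound w c) where

      -- Each draw overrides `g` to a genuine assignment, so the form bound holds draw by draw and
      -- passes to the average. As `g` is independent of the draw, its collision comes out of the
      -- expectation as a factor.
      override-bound : ∀ {g} → IsAssignment G g →
        ∑[ e < |E| ] ∑[ e′ < |E| ] (w e e′ * (agree e e′ + neither e e′ * collision e e′ g)) ≤ c
      override-bound {g} g-assignment = ≤-respˡ expand (≤-respʳ (𝔼-const c) (𝔼-mono perSample))
        where
        sample : Edge → Edge → J → Carrier
        sample e e′ j = w e e′ * (agreeing (X j) e e′ + excluded (X j) e e′ * collision e e′ g)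

        perSample : ∀ j → ∑[ e < |E| ] ∑[ e′ < |E| ] sample e e′ j ≤ c
        perSample j = ≤-trans
          (∑∑-mono |E| |E| λ e e′ → *-monoˡ-≤ (0≤w e e′) (collision-override (X j) g-assignment e e′))
          (w-bound _ (override-isAssignment (X j) g-assignment))

        expand : 𝔼 (λ j → ∑[ e < |E| ] ∑[ e′ < |E| ] sample e e′ j) ≈
                 ∑[ e < |E| ] ∑[ e′ < |E| ] (w e e′ * (agree e e′ + neither e e′ * collision e e′ g))
        expand = trans (𝔼-∑ {|E|} (λ e j → ∑[ e′ < |E| ] sample e e′ j)) (∑-cong |E| λ e →
                 trans (𝔼-∑ {|E|} (sample e)) (∑-cong |E| λ e′ →
                 trans (𝔼-homo-* _ _) (*-congˡ (trans (𝔼-homo-+ _ _) (+-congˡ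
                   (trans (𝔼-cong λ j → *-comm _ _) (trans (𝔼-homo-* _ _) (*-comm _ _))))))))

    -- Correlated sampling: keep drawing partial assignments, each vertex taking
    -- the first value it is offered, so that a pair agrees with probability at
    -- least agree / (1 - neither).  Dropping the draws after the n-th one gives
    -- the factor approach μ n.
    module _ {q : Edge → Edge → Carrier} {μ}
             (0<μ : 0# < μ) (μ≤1 : μ ≤ 1#)
             (agree≈ : ∀ e e′ → agree e e′ ≈ q e e′ * (1# - neither e e′))
             (qμ≤agree : ∀ e e′ → q e e′ * μ ≤ agree e e′) where

      -- Weights and bound are generalised for the induction: after the first draw only the pairs
      -- left undefined at both ends are pursued, so the remaining draws face the weights
      -- `w * neither` and the bound `c - ∑ w * agree`. No infinite sequence of draws is ever
      -- formed.
      truncated-sampling-bound : ∀ n {w c} → (∀ e e′ → 0# ≤ w e e′) → IsFormBound w c →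
        ∑[ e < |E| ] ∑[ e′ < |E| ] (w e e′ * (q e e′ * approach μ n)) ≤ c
      -- Without draws the claim is `0# ≤ c`, which holds because the form is nonnegative at some
      -- assignment.
      truncated-sampling-bound zero {w} 0≤w w-bound = ≤-respˡ
        (sym (∑-zero |E| λ e → ∑-zero |E| λ e′ → trans (*-congˡ (zeroʳ _)) (zeroʳ _)))
        (≤-trans (form-nonNegative someAssignment 0≤w) (w-bound _ someAssignment))
        where
        someAssignment : IsAssignment G (deterministic λ _ → someLetter)
        someAssignment = deterministic-isAssignment _
      truncated-sampling-bound (suc n) {w} {c} 0≤w w-bound = ≤-trans
        (∑∑-mono |E| |E| λ e e′ → ≤-respʳ (distribˡ _ _ _) (*-monoˡ-≤ (0≤w e e′) (onePair e e′)))
        (≤-respˡ (sym (∑∑-distrib-+ |E| |E| _ _)) (≤-from-difference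
          (solve 3 (λ c a b → c :- (a :+ b) := (c :- a) :- b) refl _ _ _)
          (x≤y⇒0≤y-x (≤-respˡ (∑∑-cong |E| |E| λ e e′ → *-assoc _ _ _)
            (truncated-sampling-bound n (λ e e′ → *-nonNegative (0≤w e e′) (neither-nonNegative e e′)) rest-bound)))))
        where
        a : Carrier
        a = approach μ n

        onePair : ∀ e e′ → q e e′ * (a + μ * (1# - a)) ≤ agree e e′ + neither e e′ * (q e e′ * a)
        -- The difference combines, with weights `1 - a` and `a`, the nonnegative `agree - q μ` and
        -- the vanishing `agree - q (1 - neither)`.
        onePair e e′ = ≤-from-difference
          (trans (solve 5 (λ g r q a m → (g :+ r :* (q :* a)) :- q :* (a :+ m :* (con (+ 1) :- a))
                     := (g :- q :* m) :* (con (+ 1) :- a) :+ a :* (g :- q :* (con (+ 1) :- r))) refl _ _ _ _ _)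
            (trans (+-congˡ (trans (*-congˡ (trans (+-congʳ (agree≈ e e′)) (-‿inverseʳ _))) (zeroʳ _))) (+-identityʳ _)))
          (*-nonNegative (x≤y⇒0≤y-x (qμ≤agree e e′)) (x≤y⇒0≤y-x (approach≤1 0<μ μ≤1 n)))

        rest-bound : IsFormBound (λ e e′ → w e e′ * neither e e′) (c - ∑[ e < |E| ] ∑[ e′ < |E| ] (w e e′ * agree e e′))
        rest-bound g g-assignment = ≤-from-difference
          (trans (solve 3 (λ c a b → (c :- a) :- b := c :- (a :+ b)) refl _ _ _)
            (+-congˡ (-‿cong (trans (sym (∑∑-distrib-+ |E| |E| _ _)) (∑∑-cong |E| |E| λ e e′ →
              trans (+-congˡ (*-assoc _ _ _)) (sym (distribˡ _ _ _)))))))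
          (x≤y⇒0≤y-x (override-bound 0≤w w-bound g-assignment))

      sampling-bound : ∀ {w c} → (∀ e e′ → 0# ≤ w e e′) → IsFormBound w c →
                       ∑[ e < |E| ] ∑[ e′ < |E| ] (w e e′ * q e e′) ≤ c
      sampling-bound 0≤w w-bound = ≤-limit 0<μ μ≤1 λ n → ≤-respˡ
        (trans (∑∑-cong |E| |E| λ e e′ → sym (*-assoc _ _ _)) (sym (*-distribʳ-∑∑ |E| |E| _ _)))
        (truncated-sampling-bound n 0≤w w-bound)

-- The tangent-line and AM-GM inequalities for a single pair.

module ElementaryInequalities (ℝ : CompleteOrderedField) where

  open CompleteOrderedField ℝ hiding (zero)
  open OrderedFieldProperties ℝ

  -- Writing a for t² and z for tρ: the assumptions give z ≤ d (q + a) / (1 + q),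
  -- which is concave in q; the conclusion is its tangent line at q = a.
  tangent-bound : ∀ {a z q m d} → 0# ≤ d → a ≤ 1# → 0# ≤ a → 0# ≤ q →
    2# * z ≤ q * m + a * m → q * m + m ≤ 2# * d →
    (1# + a) ² * z ≤ d * ((1# + a) ² - (1# - a) * (2# * (1# + a) - 1# - q))
  tangent-bound {a} {z} {q} {m} {d} 0≤d a≤1 0≤a 0≤q 2z≤ ≤2d = *-cancelˡ-≤ 0<2[1+q] (≤-from-difference
    (solve 5 (λ a z q m d → let one = con (+ 1); two = con (+ 2); b = one :+ a in
        two :* (one :+ q) :* (d :* (b :* b :- (one :- a) :* (two :* b :- one :- q))) :- two :* (one :+ q) :* (b :* b :* z)
        := b :* b :* ((two :* d :- (q :* m :+ m)) :* (q :+ a) :+ (one :+ q) :* ((q :* m :+ a :* m) :- two :* z))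
           :+ two :* d :* ((one :- a) :* ((a :- q) :* (a :- q))))
      refl a z q m d)
    (+-nonNegative
      (*-nonNegative (²-nonNegative _) (+-nonNegative
        (*-nonNegative (x≤y⇒0≤y-x ≤2d) (+-nonNegative 0≤q 0≤a))
        (*-nonNegative (+-nonNegative 0≤1 0≤q) (x≤y⇒0≤y-x 2z≤))))
      (*-nonNegative (*-nonNegative 0≤2 0≤d) (*-nonNegative (x≤y⇒0≤y-x a≤1) (²-nonNegative _)))))
    where
    0<2[1+q] : 0# < 2# * (1# + q)
    0<2[1+q] = *-positive 0<2 (+-positive 0<1 0≤q)

  -- The excess is `k (x - ty)² + (1 - k) (ty)²`. The factor `k` is kept on `x²` alone: when `x` is
  -- the smaller mass, the two terms on the right integrate to `agreement-mass` and
  -- `t ² * union-mass`.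
  weighted-AM-GM : ∀ {k t} x y → 0# ≤ k → k ≤ 1# → 2# * (t * (x * y * k)) ≤ k * x ² + t ² * y ²
  weighted-AM-GM {k} {t} x y 0≤k k≤1 = ≤-from-difference
    (solve 4 (λ k t x y → k :* (x :* x) :+ t :* t :* (y :* y) :- con (+ 2) :* (t :* (x :* y :* k))
                := k :* ((x :- t :* y) :* (x :- t :* y)) :+ (con (+ 1) :- k) :* ((t :* y) :* (t :* y))) refl k t x y)
    (+-nonNegative (*-nonNegative 0≤k (²-nonNegative _)) (*-nonNegative (x≤y⇒0≤y-x k≤1) (²-nonNegative _)))

-- Integration over a finite measure space.

module Integrals (ℝ : CompleteOrderedField) (Ω : ProjectionGames.FiniteMeasureSpace ℝ) where

  open CompleteOrderedField ℝ hiding (zero)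
  open OrderedFieldProperties ℝ
  open FiniteSums ℝ
  open ProjectionGames ℝ
  open FiniteMeasureSpace Ω

  ∫-cong : ∀ {f g} → (∀ ω → f ω ≈ g ω) → ∫ f ≈ ∫ g
  ∫-cong f≈g = ∑-cong size λ ω → *-congˡ (f≈g ω)

  ∫-mono : ∀ {f g} → (∀ ω → f ω ≤ g ω) → ∫ f ≤ ∫ g
  ∫-mono f≤g = ∑-mono size λ ω → *-monoˡ-≤ (measure-nonNegative ω) (f≤g ω)

  ∫-nonNegative : ∀ {f} → (∀ ω → 0# ≤ f ω) → 0# ≤ ∫ f
  ∫-nonNegative 0≤f = ∑-nonNegative size λ ω → *-nonNegative (measure-nonNegative ω) (0≤f ω)

  ∫-homo-+ : ∀ f g → ∫ (λ ω → f ω + g ω) ≈ ∫ f + ∫ g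
  ∫-homo-+ f g = trans (∑-cong size λ ω → distribˡ _ _ _) (∑-distrib-+ size _ _)

  ∫-homo-minus : ∀ f g → ∫ (λ ω → f ω - g ω) ≈ ∫ f - ∫ g
  ∫-homo-minus f g = trans (∑-cong size λ ω → solve 3 (λ m x y → m :* (x :- y) := m :* x :- m :* y) refl _ _ _)
    (∑-distrib-minus size _ _)

  ∫-homo-* : ∀ c f → ∫ (λ ω → c * f ω) ≈ c * ∫ f
  ∫-homo-* c f = trans (∑-cong size λ ω → solve 3 (λ m c x → m :* (c :* x) := c :* (m :* x)) refl _ _ _)
    (sym (*-distribˡ-∑ size c _))

  ∫-∑ : ∀ n (f : Fin n → Fin size → Carrier) → ∫ (λ ω → ∑[ i < n ] f i ω) ≈ ∑[ i < n ] ∫ (f i)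
  ∫-∑ n f = trans (∑-cong size λ ω → *-distribˡ-∑ n _ _) (∑-comm size n _)

-- The bound for a single vector assignment.

module VectorAssignmentBound
  (ℝ : CompleteOrderedField) (G : ProjectionGames.ProjectionGame ℝ) (Ω : ProjectionGames.FiniteMeasureSpace ℝ) where

  open CompleteOrderedField ℝ hiding (zero)
  open OrderedFieldProperties ℝ
  open ElementaryInequalities ℝ
  open FiniteSums ℝ
  open LayerCakes ℝ
  open Expectations ℝ
  open ProjectionGames ℝ
  open ProjectionGame G
  open FiniteMeasureSpace Ω
  open Integrals ℝ Ω
  open CollisionForm ℝ G
  open CorrelatedSampling ℝ G

  module _ (f : V → Alphabet → Fin size → Carrier) (0≤f : ∀ v β ω → 0# ≤ f v β ω) where

    private
      mass : V → Fin size → Carrier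
      mass v ω = ∑[ β < |Σ| ] f v β ω

      0≤mass : ∀ v ω → 0# ≤ mass v ω
      0≤mass v ω = ∑-nonNegative |Σ| λ β → 0≤f v β ω

      -- A fixed letter is the default at zero mass. `mass*normalise` survives there because `f`,
      -- being nonnegative with sum 0, vanishes.
      normalise : Fin size → V → Alphabet → Carrier
      normalise ω v β with mass v ω ≟ 0#
      ... | yes _ = deterministic (λ _ → someLetter) v β
      ... | no  _ = f v β ω / mass v ω

      mass*normalise : ∀ ω v β → mass v ω * normalise ω v β ≈ f v β ω
      mass*normalise ω v β with mass v ω ≟ 0#
      ... | no  mass≉0 = trans (*-comm _ _) (/-cancelʳ mass≉0)
      ... | yes mass≈0 = trans (*-congʳ mass≈0) (trans (zeroˡ _) (≤-antisym (0≤f v β ω)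
              (≤-respʳ mass≈0 (term≤∑ |Σ| (λ β′ → 0≤f v β′ ω) β))))

      normalise-nonNegative : ∀ ω v β → 0# ≤ normalise ω v β
      normalise-nonNegative ω v β with mass v ω ≟ 0#
      ... | yes _      = indicator-nonNegative _
      ... | no  mass≉0 = /-nonNegative (0≤f v β ω) (0≤mass v ω , λ 0≈mass → mass≉0 (sym 0≈mass))

      ∑-normalise : ∀ ω v → ∑[ β < |Σ| ] normalise ω v β ≈ 1#
      ∑-normalise ω v with mass v ω ≟ 0#
      ... | yes _      = IsAssignment.normalised (deterministic-isAssignment λ _ → someLetter) v
      ... | no  mass≉0 = trans (sym (*-distribʳ-∑ |Σ| _ _)) (⁻¹-inverseʳ mass≉0)

      normalise-isAssignment : ∀ ω → IsAssignment G (normalise ω)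
      normalise-isAssignment ω = record { nonNegative = normalise-nonNegative ω ; normalised = ∑-normalise ω }

      module Cake (ω : Fin size) = LayerCake (λ v → mass v ω ²) (λ v → ²-nonNegative (mass v ω))

      totalHeight : Fin size → Carrier
      totalHeight ω = ∑[ j < Cake.count ω ] Cake.height ω j

      Sample : Set
      Sample = Maybe (Σ[ ω ∈ Fin size ] Fin (Cake.count ω))

      sample : Sample → PartialAssignment
      sample nothing        = record
        { domain = λ _ → false ; value = deterministic (λ _ → someLetter) ; isAssignment = deterministic-isAssignment _ }
      sample (just (ω , j)) = record
        { domain = Cake.inLayer ω j ; value = normalise ω ; isAssignment = normalise-isAssignment ω }

      overLayers : (Sample → Carrier) → Fin size → Carrier
      overLayers F ω = ∑[ j < Cake.count ω ] (Cake.height ω j * F (just (ω , j)))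

      total : (Sample → Carrier) → Carrier
      total F = F nothing + ∫ (overLayers F)

      -- The empty partial assignment has mass 1, so that the total mass is positive.
      K : Carrier
      K = 1# + ∫ totalHeight

      0<K : 0# < K
      0<K = +-positive 0<1 (∫-nonNegative λ ω → ∑-nonNegative _ (Cake.height-nonNegative ω))

      expectation : Expectation Sample
      expectation = record
        { 𝔼        = λ F → total F / K
        ; 𝔼-mono   = λ F≤H → *-monoʳ-≤ (proj₁ (⁻¹-positive 0<K)) (+-mono-≤ (F≤H _)
            (∫-mono λ ω → ∑-mono _ λ j → *-monoˡ-≤ (Cake.height-nonNegative ω j) (F≤H _)))
        ; 𝔼-homo-+ = λ F H → trans
            (*-congʳ (trans (+-congˡ (trans (∫-cong λ ω → trans (∑-cong (Cake.count ω) λ j → distribˡ _ _ _) (∑-distrib-+ (Cake.count ω) _ _))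
                                           (∫-homo-+ (overLayers F) (overLayers H))))
              (solve 4 (λ a b c d → a :+ b :+ (c :+ d) := a :+ c :+ (b :+ d)) refl _ _ _ _)))
            (distribʳ _ _ _)
        ; 𝔼-homo-* = λ c F → trans
            (*-congʳ (trans (+-congˡ (trans (∫-cong λ ω → trans
                (∑-cong (Cake.count ω) λ j → solve 3 (λ h c x → h :* (c :* x) := c :* (h :* x)) refl _ _ _)
                (sym (*-distribˡ-∑ (Cake.count ω) c _))) (∫-homo-* c (overLayers F))))
              (sym (distribˡ _ _ _))))
            (*-assoc _ _ _)
        ; 𝔼-1      = trans (*-congʳ (+-congˡ (∫-cong λ ω → ∑-cong (Cake.count ω) λ j → *-identityʳ _))) (⁻¹-inverseʳ (0<⇒≉0 0<K))
        }

      -- The first two are the minimum and the maximum of the squared masses, obtained as the total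
      -- height of the layers containing both ends, respectively at least one end.
      least greatest similarity : Edge → Edge → Fin size → Carrier
      least e e′ ω      = Cake.common ω (right e) (right e′)
      greatest e e′ ω   = mass (right e) ω ² + mass (right e′) ω ² - least e e′ ω
      similarity e e′ ω = collision e e′ (normalise ω)

      agreement-mass union-mass : Edge → Edge → Carrier
      agreement-mass e e′ = ∫ (λ ω → similarity e e′ ω * least e e′ ω)
      union-mass e e′     = ∫ (greatest e e′)

      agree≈ : ∀ e e′ → agree expectation sample e e′ ≈ agreement-mass e e′ / K
      agree≈ e e′ = *-congʳ (trans (+-cong (trans (*-congʳ (zeroˡ _)) (zeroˡ _)) (∫-cong λ ω → trans
        (∑-cong (Cake.count ω) λ j → solve 3 (λ h i k → h :* (i :* k) := k :* (h :* i)) refl _ _ _)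
        (sym (*-distribˡ-∑ (Cake.count ω) _ _)))) (+-identityˡ _))

      -- Inclusion-exclusion in each layer; the empty draw excludes every pair and accounts for the
      -- summand 1 of `K`.
      neither≈ : ∀ e e′ → neither expectation sample e e′ ≈ (K - union-mass e e′) / K
      neither≈ e e′ = *-congʳ (trans
        (+-cong (solve 0 ((con (+ 1) :- con (+ 0)) :* (con (+ 1) :- con (+ 0)) := con (+ 1)) refl)
          (trans (∫-cong outsideLayers) (∫-homo-minus totalHeight (greatest e e′))))
        (sym (+-assoc _ _ _)))
        where
        outsideLayers : ∀ ω → overLayers (λ j → PartialAssignment.excluded (sample j) e e′) ω ≈ totalHeight ω - greatest e e′ ω
        outsideLayers ω = trans
          (∑-cong count λ j → solve 3 (λ h i k → h :* ((con (+ 1) :- i) :* (con (+ 1) :- k))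
                                   := h :- (h :* i :+ h :* k :- h :* (i :* k))) refl _ _ _)
          (trans (∑-distrib-minus count _ _) (+-congˡ (-‿cong (trans (∑-distrib-minus count _ _)
            (+-congʳ (trans (∑-distrib-+ count _ _) (+-cong (∑-layers (right e)) (∑-layers (right e′)))))))))
          where open Cake ω

      ordered : ∀ e e′ ω → let x = mass (right e) ω; y = mass (right e′) ω in
        (x ² ≤ y ² × least e e′ ω ≈ x ² × greatest e e′ ω ≈ y ²) ⊎ (y ² ≤ x ² × least e e′ ω ≈ y ² × greatest e e′ ω ≈ x ²)
      ordered e e′ ω with ≤-total (mass (right e) ω ²) (mass (right e′) ω ²)
      ... | inj₁ x²≤y² = inj₁ (x²≤y² , Cake.common-≤ ω x²≤y² , trans (+-congˡ (-‿cong (Cake.common-≤ ω x²≤y²)))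
              (solve 2 (λ x y → x :+ y :- x := y) refl _ _))
      ... | inj₂ y²≤x² = inj₂ (y²≤x² , Cake.common-≥ ω y²≤x² , trans (+-congˡ (-‿cong (Cake.common-≥ ω y²≤x²)))
              (solve 2 (λ x y → x :+ y :- y := x) refl _ _))

      0≤similarity : ∀ e e′ ω → 0# ≤ similarity e e′ ω
      0≤similarity e e′ ω = collision-nonNegative (normalise-nonNegative ω) e e′

      similarity≤1 : ∀ e e′ ω → similarity e e′ ω ≤ 1#
      similarity≤1 e e′ ω = collision≤1 (normalise-isAssignment ω) e e′

      0≤least : ∀ e e′ ω → 0# ≤ least e e′ ω
      0≤least e e′ ω with ordered e e′ ω
      ... | inj₁ (_ , least≈ , _) = ≤-respʳ (sym least≈) (²-nonNegative _)
      ... | inj₂ (_ , least≈ , _) = ≤-respʳ (sym least≈) (²-nonNegative _)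

      least≤greatest : ∀ e e′ ω → least e e′ ω ≤ greatest e e′ ω
      least≤greatest e e′ ω with ordered e e′ ω
      ... | inj₁ (x²≤y² , least≈ , greatest≈) = ≤-respˡ (sym least≈) (≤-respʳ (sym greatest≈) x²≤y²)
      ... | inj₂ (y²≤x² , least≈ , greatest≈) = ≤-respˡ (sym least≈) (≤-respʳ (sym greatest≈) y²≤x²)

      similarity*least≤least : ∀ e e′ ω → similarity e e′ ω * least e e′ ω ≤ least e e′ ω
      similarity*least≤least e e′ ω = ≤-respʳ (*-identityˡ _) (*-monoʳ-≤ (0≤least e e′ ω) (similarity≤1 e e′ ω))

      0≤agreement-mass : ∀ e e′ → 0# ≤ agreement-mass e e′
      0≤agreement-mass e e′ = ∫-nonNegative λ ω → *-nonNegative (0≤similarity e e′ ω) (0≤least e e′ ω)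

      agreement-mass≤union-mass : ∀ e e′ → agreement-mass e e′ ≤ union-mass e e′
      agreement-mass≤union-mass e e′ = ∫-mono λ ω → ≤-trans (similarity*least≤least e e′ ω) (least≤greatest e e′ ω)

      0≤union-mass : ∀ e e′ → 0# ≤ union-mass e e′
      0≤union-mass e e′ = ≤-trans (0≤agreement-mass e e′) (agreement-mass≤union-mass e e′)

      -- Equal to 0 when union-mass is, whatever 0# ⁻¹ may be.
      quality : Edge → Edge → Carrier
      quality e e′ = agreement-mass e e′ / union-mass e e′

      agreement-mass≈0 : ∀ e e′ → union-mass e e′ ≈ 0# → agreement-mass e e′ ≈ 0#
      agreement-mass≈0 e e′ union≈0 =
        ≤-antisym (≤-respʳ union≈0 (agreement-mass≤union-mass e e′)) (0≤agreement-mass e e′)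

      quality*union-mass : ∀ e e′ → quality e e′ * union-mass e e′ ≈ agreement-mass e e′
      quality*union-mass e e′ with union-mass e e′ ≟ 0#
      ... | no  union≉0 = /-cancelʳ union≉0
      ... | yes union≈0 = trans (trans (*-congˡ union≈0) (zeroʳ _)) (sym (agreement-mass≈0 e e′ union≈0))

      quality≈0 : ∀ e e′ → union-mass e e′ ≈ 0# → quality e e′ ≈ 0#
      quality≈0 e e′ union≈0 = trans (*-congʳ (agreement-mass≈0 e e′ union≈0)) (zeroˡ _)

      0<union-mass : ∀ e e′ → ¬ (union-mass e e′ ≈ 0#) → 0# < union-mass e e′
      0<union-mass e e′ union≉0 = 0≤union-mass e e′ , λ 0≈union → union≉0 (sym 0≈union)

      0≤quality : ∀ e e′ → 0# ≤ quality e e′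
      0≤quality e e′ with union-mass e e′ ≟ 0#
      ... | no  union≉0 = /-nonNegative (0≤agreement-mass e e′) (0<union-mass e e′ union≉0)
      ... | yes union≈0 = ≤-reflexive (sym (quality≈0 e e′ union≈0))

      -- `quality` acts as the probability of agreement conditioned on a draw that is defined at one
      -- end or more; the normalisation `K` cancels.
      agree≈quality : ∀ e e′ → agree expectation sample e e′ ≈ quality e e′ * (1# - neither expectation sample e e′)
      agree≈quality e e′ = begin
        agree expectation sample e e′                         ≈⟨ agree≈ e e′ ⟩
        agreement-mass e e′ / K                               ≈⟨ *-congʳ (quality*union-mass e e′) ⟨
        quality e e′ * union-mass e e′ / K                    ≈⟨ *-assoc _ _ _ ⟩
        quality e e′ * (union-mass e e′ / K)                  ≈⟨ *-congˡ union/K ⟩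
        quality e e′ * (1# - (K - union-mass e e′) / K)       ≈⟨ *-congˡ (+-congˡ (-‿cong (neither≈ e e′))) ⟨
        quality e e′ * (1# - neither expectation sample e e′) ∎
        where
        open SetoidReasoning setoid

        union/K : union-mass e e′ / K ≈ 1# - (K - union-mass e e′) / K
        union/K = trans (solve 3 (λ k u i → u :* i := k :* i :- (k :- u) :* i) refl K _ _)
          (+-congʳ (⁻¹-inverseʳ (0<⇒≉0 0<K)))

      -- The mass replaced by 1 where it vanishes, so that all entries are positive.
      gap : Edge → Edge → Carrier
      gap e e′ with union-mass e e′ ≟ 0#
      ... | yes _ = 1#
      ... | no  _ = union-mass e e′ / K

      0<gap : ∀ e e′ → 0# < gap e e′
      0<gap e e′ with union-mass e e′ ≟ 0#
      ... | yes _       = 0<1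
      ... | no  union≉0 = *-positive (0<union-mass e e′ union≉0) (⁻¹-positive 0<K)

      -- Truncated sampling uses one rate for all pairs. Finiteness of the edge set provides it, as
      -- a lower bound of the row-wise lower bounds.
      uniform-gap : ∃ λ μ → 0# < μ × μ ≤ 1# × (∀ e e′ → μ ≤ gap e e′)
      uniform-gap =
        let row = λ e → positive-lowerBound (gap e) (0<gap e)
            μ , 0<μ , μ≤1 , μ≤row = positive-lowerBound (λ e → proj₁ (row e)) (λ e → proj₁ (proj₂ (row e)))
        in μ , 0<μ , μ≤1 , λ e e′ → ≤-trans (μ≤row e) (proj₂ (proj₂ (proj₂ (row e))) e′)

      quality*gap≤agree : ∀ e e′ {μ} → μ ≤ gap e e′ → quality e e′ * μ ≤ agree expectation sample e e′
      quality*gap≤agree e e′ {μ} μ≤gap with union-mass e e′ ≟ 0#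
      ... | yes union≈0 = ≤-reflexive (trans (trans (*-congʳ (quality≈0 e e′ union≈0)) (zeroˡ _))
              (sym (trans (agree≈ e e′) (trans (*-congʳ (agreement-mass≈0 e e′ union≈0)) (zeroˡ _)))))
      ... | no  _       = ≤-respʳ
              (trans (sym (*-assoc _ _ _)) (trans (*-congʳ (quality*union-mass e e′)) (sym (agree≈ e e′))))
              (*-monoˡ-≤ (0≤quality e e′) μ≤gap)

      ∑-quality≤ : ∀ {c} → IsFormBound pairWeight c →
                   ∑[ e < |E| ] ∑[ e′ < |E| ] (pairWeight e e′ * quality e e′) ≤ c
      ∑-quality≤ bound = let μ , 0<μ , μ≤1 , μ≤gap = uniform-gap in
        sampling-bound expectation sample 0<μ μ≤1 agree≈quality (λ e e′ → quality*gap≤agree e e′ (μ≤gap e e′))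
          pairWeight-nonNegative bound

      correlation : Edge → Edge → Carrier
      correlation e e′ = ∫ (λ ω → collision e e′ (λ v β → f v β ω))

      push-scale : ∀ e ω α → push e (λ v β → f v β ω) α ≈ mass (right e) ω * push e (normalise ω) α
      push-scale e ω α = trans
        (∑-cong |Σ| λ β → trans (*-congˡ (sym (mass*normalise ω (right e) β)))
          (solve 3 (λ i x y → i :* (x :* y) := x :* (i :* y)) refl _ _ _))
        (sym (*-distribˡ-∑ |Σ| _ _))

      collision-scale : ∀ e e′ ω → collision e e′ (λ v β → f v β ω) ≈
                        mass (right e) ω * mass (right e′) ω * similarity e e′ ω
      collision-scale e e′ ω = trans
        (∑-cong |Σ| λ α → trans (*-cong (push-scale e ω α) (push-scale e′ ω α))
          (solve 4 (λ x p y r → x :* p :* (y :* r) := x :* y :* (p :* r)) refl _ _ _ _))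
        (sym (*-distribˡ-∑ |Σ| _ _))

      -- At each `ω` AM-GM is applied with the smaller mass in first place, so that the factor
      -- `similarity` always lands on `least`.
      correlation≤ : ∀ t e e′ → 2# * (t * correlation e e′) ≤ agreement-mass e e′ + t ² * union-mass e e′
      correlation≤ t e e′ = ≤-respˡ
        (trans (∫-homo-* 2# _) (*-congˡ (trans (∫-homo-* t _) (*-congˡ (∫-cong λ ω → sym (collision-scale e e′ ω))))))
        (≤-respʳ (trans (∫-homo-+ _ _) (+-congˡ (∫-homo-* (t ²) _))) (∫-mono pointwise))
        where
        pointwise : ∀ ω → let x = mass (right e) ω; y = mass (right e′) ω; k = similarity e e′ ω in
          2# * (t * (x * y * k)) ≤ k * least e e′ ω + t ² * greatest e e′ ω
        pointwise ω with ordered e e′ ω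
        ... | inj₁ (_ , least≈ , greatest≈) = ≤-respʳ (sym (+-cong (*-congˡ least≈) (*-congˡ greatest≈)))
                (weighted-AM-GM _ _ (0≤similarity e e′ ω) (similarity≤1 e e′ ω))
        ... | inj₂ (_ , least≈ , greatest≈) = ≤-respʳ (sym (+-cong (*-congˡ least≈) (*-congˡ greatest≈)))
                (≤-respˡ (*-congˡ (*-congˡ (*-congʳ (*-comm _ _))))
                  (weighted-AM-GM _ _ (0≤similarity e e′ ω) (similarity≤1 e e′ ω)))

    module _ {d} (0≤d : 0# ≤ d) (mass²≤d : ∀ v → ∫ (λ ω → (∑[ β < |Σ| ] f v β ω) ²) ≤ d) where

      -- Once `similarity` is bounded by 1, minimum plus maximum is the sum of the two squared
      -- masses.
      agreement+union≤ : ∀ e e′ → agreement-mass e e′ + union-mass e e′ ≤ 2# * d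
      agreement+union≤ e e′ = ≤-trans
        (≤-respˡ (∫-homo-+ _ _) (∫-mono λ ω → ≤-respʳ (solve 3 (λ l x y → l :+ (x :+ y :- l) := x :+ y) refl _ _ _)
          (+-mono-≤ (similarity*least≤least e e′ ω) ≤-refl)))
        (≤-respˡ (sym (∫-homo-+ _ _)) (≤-respʳ (solve 1 (λ d → d :+ d := con (+ 2) :* d) refl d)
          (+-mono-≤ (mass²≤d (right e)) (mass²≤d (right e′)))))

      pair-bound : ∀ {t} → t ² ≤ 1# → ∀ e e′ →
        (1# + t ²) ² * (t * correlation e e′) ≤ d * ((1# + t ²) ² - (1# - t ²) * (2# * (1# + t ²) - 1# - quality e e′))
      pair-bound {t} t²≤1 e e′ = tangent-bound {m = union-mass e e′} 0≤d t²≤1 (²-nonNegative t) (0≤quality e e′)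
        (≤-respʳ (+-congʳ (sym (quality*union-mass e e′))) (correlation≤ t e e′))
        (≤-respˡ (+-congʳ (sym (quality*union-mass e e′))) (agreement+union≤ e e′))

      ∫-normSquared : ∫ (λ ω → normSquared G (operator G (λ v β → f v β ω))) ≈
                      ∑[ e < |E| ] ∑[ e′ < |E| ] (pairWeight e e′ * correlation e e′)
      ∫-normSquared = trans (∫-cong λ ω → normSquared-operator (λ v β → f v β ω))
        (trans (∫-∑ |E| _) (∑-cong |E| λ e → trans (∫-∑ |E| _) (∑-cong |E| λ e′ → ∫-homo-* _ _)))

      vectorAssignment-bound : ∀ {t} → 0# < t → t ≤ 1# → IsFormBound pairWeight (t ²) →
        (1# + t ²) * ∫ (λ ω → normSquared G (operator G (λ v β → f v β ω))) ≤ 2# * t * d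
      vectorAssignment-bound {t} 0<t t≤1 bound = *-cancelˡ-≤ 0<Tt (≤-respˡ
        (trans (sym (trans (*-distribˡ-∑∑ |E| |E| _ _) (∑∑-cong |E| |E| λ e e′ →
            solve 4 (λ a t w r → a :* a :* t :* (w :* r) := w :* (a :* a :* (t :* r))) refl 1+t² t _ _)))
          (trans (*-congˡ (sym ∫-normSquared)) (solve 3 (λ a t n → a :* a :* t :* n := a :* t :* (a :* n)) refl 1+t² t _)))
        (≤-trans (∑∑-mono |E| |E| λ e e′ → *-monoˡ-≤ (pairWeight-nonNegative e e′) (pair-bound t²≤1 e e′))
          -- The target exceeds the averaged tangent line by exactly `d (1 - t²) (t² - Q)`: the line
          -- is increasing in `Q`, and its value at `Q = t²` is the target.
          (≤-respˡ (sym separate) (≤-from-difference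
            (solve 3 (λ t q d → let one = con (+ 1); two = con (+ 2); b = one :+ t :* t in
                b :* t :* (two :* t :* d) :- (d :* (b :* b :- (one :- t :* t) :* (two :* b :- one)) :+ d :* (one :- t :* t) :* q)
                := d :* (one :- t :* t) :* (t :* t :- q)) refl t Q d)
            (*-nonNegative (*-nonNegative 0≤d (x≤y⇒0≤y-x t²≤1)) (x≤y⇒0≤y-x (∑-quality≤ bound)))))))
        where
        1+t² Q : Carrier
        1+t² = 1# + t ²
        Q = ∑[ e < |E| ] ∑[ e′ < |E| ] (pairWeight e e′ * quality e e′)

        t²≤1 : t ² ≤ 1#
        t²≤1 = ≤-respʳ (*-identityˡ 1#) (²-mono-≤ (proj₁ 0<t) t≤1)

        0<Tt : 0# < 1+t² * t
        0<Tt = *-positive (+-positive 0<1 (²-nonNegative t)) 0<t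

        separate : ∑[ e < |E| ] ∑[ e′ < |E| ] (pairWeight e e′ * (d * (1+t² ² - (1# - t ²) * (2# * 1+t² - 1# - quality e e′)))) ≈
                   d * (1+t² ² - (1# - t ²) * (2# * 1+t² - 1#)) + d * (1# - t ²) * Q
        separate = trans
          (∑∑-cong |E| |E| λ e e′ → solve 5 (λ w d b a q →
              w :* (d :* (b :* b :- a :* (con (+ 2) :* b :- con (+ 1) :- q)))
              := d :* (b :* b :- a :* (con (+ 2) :* b :- con (+ 1))) :* w :+ d :* a :* (w :* q)) refl _ _ _ _ _)
          (trans (∑∑-distrib-+ |E| |E| _ _) (+-cong
            (trans (sym (*-distribˡ-∑∑ |E| |E| _ _)) (trans (*-congˡ ∑∑-pairWeight) (*-identityʳ _)))
            (sym (*-distribˡ-∑∑ |E| |E| _ _))))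

-- Passing to the suprema `val`, `collisionValue` and `val₊`.

module GameValues (ℝ : CompleteOrderedField) (G : ProjectionGames.ProjectionGame ℝ) where

  open CompleteOrderedField ℝ hiding (zero)
  open OrderedFieldProperties ℝ
  open FiniteSums ℝ
  open ProjectionGames ℝ
  open ProjectionGame G
  open CollisionForm ℝ G
  open CorrelatedSampling ℝ G
  open PartialOrderReasoning poset

  module _ {g} (g-assignment : IsAssignment G g) where

    open IsAssignment g-assignment

    operator-nonNegative : ∀ u α → 0# ≤ operator G g u α
    operator-nonNegative u α = ∑-nonNegative |E| λ e →
      *-nonNegative (conditional-nonNegative u e) (push-nonNegative nonNegative e α)

    ∑-operator≤1 : ∀ u → ∑[ α < |Σ| ] operator G g u α ≤ 1#
    ∑-operator≤1 u = begin
      ∑[ α < |Σ| ] ∑[ e < |E| ] (conditional u e * push e g α)   ≈⟨ ∑-comm |Σ| |E| _ ⟩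
      ∑[ e < |E| ] ∑[ α < |Σ| ] (conditional u e * push e g α)   ≈⟨ ∑-cong |E| (λ e → *-distribˡ-∑ |Σ| _ _) ⟨
      ∑[ e < |E| ] (conditional u e * (∑[ α < |Σ| ] push e g α)) ≤⟨ convexCombination≤ |E| _ _ (conditional-nonNegative u)
                                                                      (∑-conditional u) (∑-push≤1 g-assignment) ⟩
      1#                                                         ∎

    bestLetter : U → Alphabet
    bestLetter u = proj₁ (maximum someLetter (operator G g u))

    -- A sum of squares is at most the maximum times the sum, and here the sum is at most 1.
    ∑-operator²≤ : ∀ u → ∑[ α < |Σ| ] (operator G g u α ²) ≤ operator G g u (bestLetter u)
    ∑-operator²≤ u = begin
      ∑[ α < |Σ| ] (operator G g u α ²)
        ≤⟨ ∑-mono |Σ| (λ α → *-monoˡ-≤ (operator-nonNegative u α) (proj₂ (maximum someLetter (operator G g u)) α)) ⟩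
      ∑[ α < |Σ| ] (operator G g u α * operator G g u (bestLetter u))
        ≈⟨ *-distribʳ-∑ |Σ| _ _ ⟨
      (∑[ α < |Σ| ] operator G g u α) * operator G g u (bestLetter u)
        ≤⟨ *-monoʳ-≤ (operator-nonNegative u _) (∑-operator≤1 u) ⟩
      1# * operator G g u (bestLetter u)
        ≈⟨ *-identityˡ _ ⟩
      operator G g u (bestLetter u) ∎

    -- The part of the agreement with `bestLetter` that the reply `β` earns at `v`.
    score : V → Alphabet → Carrier
    score v β = ∑[ e < |E| ] (indicator ⌊ right e Fin.≟ v ⌋ * (probability e * indicator (constraint e (bestLetter (left e)) β)))

    bestReply : V → Alphabet
    bestReply v = proj₁ (maximum someLetter (score v))

    -- Derandomisation, one side at a time. With the left side rounded to its largest letters, the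
    -- quantity is linear in `g` at each right vertex, so the best single letter does at least as
    -- well as the distribution.
    normSquared≤agreement : normSquared G (operator G g) ≤ agreement G bestLetter bestReply
    normSquared≤agreement = begin
      ∑[ u < |U| ] (measureU u * (∑[ α < |Σ| ] (operator G g u α ²)))
        ≤⟨ ∑-mono |U| (λ u → *-monoˡ-≤ (proj₁ (measureU-positive u)) (∑-operator²≤ u)) ⟩
      ∑[ u < |U| ] (measureU u * (∑[ e < |E| ] (conditional u e * push e g (bestLetter u))))
        ≈⟨ ∑-cong |U| (λ u → trans (*-distribˡ-∑ |E| _ _) (∑-cong |E| λ e →
             trans (sym (*-assoc _ _ _)) (trans (*-congʳ (measureU*conditional u e)) (*-assoc _ _ _)))) ⟩
      ∑[ u < |U| ] ∑[ e < |E| ] (indicator ⌊ left e Fin.≟ u ⌋ * (probability e * push e g (bestLetter u)))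
        ≈⟨ trans (∑-comm |U| |E| _) (∑-cong |E| λ e → ∑-indicator (left e) (λ u → probability e * push e g (bestLetter u))) ⟩
      ∑[ e < |E| ] (probability e * push e g (bestLetter (left e)))
        ≈⟨ ∑-cong |E| (λ e → ∑-indicator (right e) (λ v → probability e *
             (∑[ β < |Σ| ] (indicator (constraint e (bestLetter (left e)) β) * g v β)))) ⟨
      ∑[ e < |E| ] ∑[ v < |V| ] (indicator ⌊ right e Fin.≟ v ⌋ * (probability e *
        (∑[ β < |Σ| ] (indicator (constraint e (bestLetter (left e)) β) * g v β))))
        ≈⟨ trans (∑-comm |E| |V| _) (∑-cong |V| collectScores) ⟩
      ∑[ v < |V| ] ∑[ β < |Σ| ] (g v β * score v β)
        ≤⟨ ∑-mono |V| (λ v → convexCombination≤ |Σ| (g v) (score v) (nonNegative v) (normalised v)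
             (proj₂ (maximum someLetter (score v)))) ⟩
      ∑[ v < |V| ] score v (bestReply v)
        ≈⟨ trans (∑-comm |V| |E| _) (∑-cong |E| λ e → ∑-indicator (right e)
             (λ v → probability e * indicator (constraint e (bestLetter (left e)) (bestReply v)))) ⟩
      agreement G bestLetter bestReply ∎
      where
      collectScores : ∀ v →
        ∑[ e < |E| ] (indicator ⌊ right e Fin.≟ v ⌋ * (probability e *
          (∑[ β < |Σ| ] (indicator (constraint e (bestLetter (left e)) β) * g v β)))) ≈
        ∑[ β < |Σ| ] (g v β * score v β)
      collectScores v = trans
        (∑-cong |E| λ e → trans (*-congˡ (*-distribˡ-∑ |Σ| _ _)) (*-distribˡ-∑ |Σ| _ _))
        (trans (∑-comm |E| |Σ| _) (∑-cong |Σ| λ β → trans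
          (∑-cong |E| λ e → solve 4 (λ i p k x → i :* (p :* (k :* x)) := x :* (i :* (p :* k))) refl _ _ _ _)
          (sym (*-distribˡ-∑ |E| _ _))))

  agreement-nonNegative : ∀ a b → 0# ≤ agreement G a b
  agreement-nonNegative a b = ∑-nonNegative |E| λ e → *-nonNegative (probability-nonNegative e) (indicator-nonNegative _)

  agreement≤1 : ∀ a b → agreement G a b ≤ 1#
  agreement≤1 a b = convexCombination≤ |E| _ _ probability-nonNegative ∑-probability λ e → indicator≤1 _

  constantLetters : (U → Alphabet) × (V → Alphabet)
  constantLetters = (λ _ → someLetter) , (λ _ → someLetter)

  agreement≤val : ∀ a b → agreement G a b ≤ val G
  agreement≤val a b = ≤-⨆ constantLetters (λ (a , b) → agreement≤1 a b) (a , b)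

  val≤1 : val G ≤ 1#
  val≤1 = ⨆-least constantLetters (λ (a , b) → agreement≤1 a b) (λ (a , b) → agreement≤1 a b)

  val-nonNegative : 0# ≤ val G
  val-nonNegative = ≤-trans (agreement-nonNegative (proj₁ constantLetters) (proj₂ constantLetters)) (agreement≤val (proj₁ constantLetters) (proj₂ constantLetters))

  normSquared-nonNegative : ∀ h → 0# ≤ normSquared G h
  normSquared-nonNegative h = ∑-nonNegative |U| λ u → *-nonNegative (proj₁ (measureU-positive u))
    (∑-nonNegative |Σ| λ α → ²-nonNegative _)

  -- Used twice: it shows that the norms are bounded, so that `collisionValue` is a genuine
  -- supremum, and it then bounds that supremum.
  norm≤√val : ∀ {g} → IsAssignment G g → norm G (operator G g) ≤ √ (val G)
  norm≤√val g-assignment = ≤-√ val-nonNegative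
    (≤-respˡ (sym (√²≈ (normSquared-nonNegative _)))
      (≤-trans (normSquared≤agreement g-assignment) (agreement≤val (bestLetter g-assignment) (bestReply g-assignment))))

  private
    constantAssignment : Σ[ g ∈ (V → Alphabet → Carrier) ] IsAssignment G g
    constantAssignment = _ , deterministic-isAssignment (λ _ → someLetter)

  norm≤collisionValue : ∀ {g} → IsAssignment G g → norm G (operator G g) ≤ collisionValue G
  norm≤collisionValue {g} g-assignment = ≤-⨆ constantAssignment (λ (_ , h) → norm≤√val h) (g , g-assignment)

  collisionValue-nonNegative : 0# ≤ collisionValue G
  collisionValue-nonNegative = ≤-trans (√-nonNegative (normSquared-nonNegative _))
    (norm≤collisionValue (proj₂ constantAssignment))

  collisionValue²≤val : collisionValue G ² ≤ val G
  collisionValue²≤val = ≤-trans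
    (²-mono-≤ collisionValue-nonNegative
      (⨆-least constantAssignment (λ (_ , h) → norm≤√val h) (λ (_ , h) → norm≤√val h)))
    (≤-reflexive (√²≈ val-nonNegative))

  collisionValue≤1 : collisionValue G ≤ 1#
  collisionValue≤1 = ²-cancel-≤ 0≤1 (≤-respʳ (sym (*-identityˡ 1#)) (≤-trans collisionValue²≤val val≤1))

  form≤ : ∀ {t} → collisionValue G ≤ t → IsFormBound pairWeight (t ²)
  form≤ c≤t g g-assignment = ≤-respˡ
    (trans (√²≈ (normSquared-nonNegative _)) (normSquared-operator g))
    (²-mono-≤ (√-nonNegative (normSquared-nonNegative _)) (≤-trans (norm≤collisionValue g-assignment) c≤t))

  -- Positive total weight forces an edge; its right endpoint makes the family under the maximum
  -- over `V` inhabited.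
  someRightVertex : V
  someRightVertex = vertex weight totalWeight-positive right
    where
    vertex : ∀ {n} (w : Fin n → Carrier) → 0# < ∑[ e < n ] w e → (Fin n → V) → V
    vertex {zero}  w (_ , 0≉0) _ = ⊥-elim (0≉0 refl)
    vertex {suc n} w _         r = r zero

  module _ (Ω : FiniteMeasureSpace) (f : VectorAssignment G Ω) where

    open FiniteMeasureSpace Ω
    open VectorAssignmentBound ℝ G Ω
    open Integrals ℝ Ω

    mass²-nonNegative : ∀ v → 0# ≤ ∫ (λ ω → (∑[ β < |Σ| ] f v β ω) ²)
    mass²-nonNegative v = ∫-nonNegative λ ω → ²-nonNegative _

    normT⊗Id≤max : ∀ v → normT⊗Id G Ω v f ≤ maxNormT⊗Id G Ω f
    -- The sum over all vertices merely witnesses that the family is bounded.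
    normT⊗Id≤max = ≤-⨆ someRightVertex (term≤∑ |V| λ v → √-nonNegative (mass²-nonNegative v))

    maxNormT⊗Id-nonNegative : 0# ≤ maxNormT⊗Id G Ω f
    maxNormT⊗Id-nonNegative = ≤-trans (√-nonNegative (mass²-nonNegative someRightVertex)) (normT⊗Id≤max someRightVertex)

    ∫-normSquared-nonNegative : 0# ≤ ∫ (λ ω → normSquared G (operator G (λ v β → f v β ω)))
    ∫-normSquared-nonNegative = ∫-nonNegative λ ω → normSquared-nonNegative _

    module _ (admissible : IsAdmissible G Ω f) where

      open IsAdmissible admissible

      0<max : 0# < maxNormT⊗Id G Ω f
      0<max = maxNormT⊗Id-nonNegative , λ 0≈max → denominator-nonZero (sym 0≈max)

      ratio : Carrier
      ratio = normG⊗Id G Ω f / maxNormT⊗Id G Ω f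

      ratio-nonNegative : 0# ≤ ratio
      ratio-nonNegative = /-nonNegative (√-nonNegative ∫-normSquared-nonNegative) 0<max

      ratio-bound : ∀ {t} → 0# < t → t ≤ 1# → collisionValue G ≤ t → ratio ² ≤ 2# * t / (1# + t ²)
      ratio-bound {t} 0<t t≤1 c≤t = ≤-/ (+-positive 0<1 (²-nonNegative t)) (*-cancelˡ-≤ (*-positive 0<max 0<max)
        (≤-respˡ (trans (*-congˡ (trans (sym (√²≈ ∫-normSquared-nonNegative))
                     (²-cong (sym (/-cancelʳ (0<⇒≉0 0<max))))))
                   (solve 3 (λ a r d → a :* (r :* d :* (r :* d)) := d :* d :* (r :* r :* a)) refl _ _ _))
          (≤-respʳ (*-comm _ _)
            (vectorAssignment-bound f nonNegative (²-nonNegative _)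
              (λ v → ≤-respˡ (√²≈ (mass²-nonNegative v)) (²-mono-≤ (√-nonNegative (mass²-nonNegative v)) (normT⊗Id≤max v)))
              0<t t≤1 (form≤ c≤t)))))

  -- With a constant letter this yields an admissible pair, so the family under the supremum `val₊`
  -- is inhabited.
  onePoint : FiniteMeasureSpace
  onePoint = record { size = 1 ; measure = λ _ → 1# ; measure-nonNegative = λ _ → 0≤1 }

  constantVectorAssignment : VectorAssignment G onePoint
  constantVectorAssignment v β _ = proj₁ constantAssignment v β

  constantVectorAssignment-isAdmissible : IsAdmissible G onePoint constantVectorAssignment
  constantVectorAssignment-isAdmissible = record
    { nonNegative         = λ v β _ → IsAssignment.nonNegative (proj₂ constantAssignment) v β
    ; denominator-nonZero = λ max≈0 → 0≉1 (trans
        (sym (x≈0⇒x²≈0 (≤-antisym (≤-respʳ max≈0 (normT⊗Id≤max onePoint constantVectorAssignment v₀))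
               (√-nonNegative (mass²-nonNegative onePoint constantVectorAssignment v₀)))))
        (trans (√²≈ (mass²-nonNegative onePoint constantVectorAssignment v₀)) mass²≈1))
    }
    where
    v₀ : V
    v₀ = someRightVertex

    mass²≈1 : 1# * (∑[ β < |Σ| ] constantVectorAssignment v₀ β zero) ² + 0# ≈ 1#
    mass²≈1 = trans (+-identityʳ _) (trans (*-identityˡ _) (trans
      (²-cong (IsAssignment.normalised (proj₂ constantAssignment) v₀)) (*-identityˡ 1#)))

  private
    Ratio : Set
    Ratio = Σ[ Ω ∈ FiniteMeasureSpace ] Σ[ f ∈ VectorAssignment G Ω ] IsAdmissible G Ω f

    someRatio : Ratio
    someRatio = onePoint , constantVectorAssignment , constantVectorAssignment-isAdmissible

  val₊²≤ : ∀ {t} → 0# < t → t ≤ 1# → collisionValue G ≤ t → val₊ G ² ≤ 2# * t / (1# + t ²)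
  val₊²≤ {t} 0<t t≤1 c≤t = ≤-respʳ (√²≈ 0≤bound) (²-mono-≤ 0≤val₊ (⨆-least someRatio ratio≤ ratio≤))
    where
    0≤bound : 0# ≤ 2# * t / (1# + t ²)
    0≤bound = /-nonNegative (*-nonNegative 0≤2 (proj₁ 0<t)) (+-positive 0<1 (²-nonNegative t))

    ratio≤ : ((Ω , f , admissible) : Ratio) → ratio Ω f admissible ≤ √ (2# * t / (1# + t ²))
    ratio≤ (Ω , f , admissible) = ≤-√ 0≤bound (ratio-bound Ω f admissible 0<t t≤1 c≤t)

    0≤val₊ : 0# ≤ val₊ G
    0≤val₊ = ≤-trans (ratio-nonNegative _ _ (proj₂ (proj₂ someRatio))) (≤-⨆ someRatio ratio≤ someRatio)

  -- A positive collision value is itself a valid `t`. If it is 0, every `t` in `(0, 1]` is valid,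
  -- and `x ≤ 2t` for all of them forces `x ≤ 0`.
  val₊²-collisionValue : val₊ G ² * (1# + collisionValue G ²) ≤ 2# * collisionValue G
  val₊²-collisionValue with collisionValue G ≤? 0#
  ... | no  c≰0 = ≤-trans
          (*-monoʳ-≤ (+-nonNegative 0≤1 (²-nonNegative _)) (val₊²≤ (≰⇒> c≰0) collisionValue≤1 ≤-refl))
          (≤-reflexive (/-cancelʳ (0<⇒≉0 (+-positive 0<1 (²-nonNegative _)))))
  ... | yes c≤0 = ≤-trans (*-monoʳ-≤ (+-nonNegative 0≤1 (²-nonNegative _)) x≤0)
          (≤-respˡ (sym (zeroˡ _)) (*-nonNegative 0≤2 collisionValue-nonNegative))
    where
    x : Carrier
    x = val₊ G ²

    x≤2t : ∀ {t} → 0# < t → t ≤ 1# → x ≤ 2# * t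
    x≤2t {t} 0<t t≤1 = ≤-trans (val₊²≤ 0<t t≤1 (≤-trans c≤0 (proj₁ 0<t)))
      (/-≤ (+-positive 0<1 (²-nonNegative t)) (≤-from-difference
        (solve 1 (λ t → con (+ 2) :* t :* (con (+ 1) :+ t :* t) :- con (+ 2) :* t := con (+ 2) :* t :* (t :* t)) refl t)
        (*-nonNegative (*-nonNegative 0≤2 (proj₁ 0<t)) (²-nonNegative t))))

    x≤0 : x ≤ 0#
    x≤0 = ≤-stable λ 0<x →
      -- The bound at `t = 1` gives `x ≤ 2`, so `x / 8` is at most 1. Then `8t = x ≤ 2t` contradicts
      -- `0 < t`; the constant 6 below is `8 - 2`.
      let t      = x / 8#
          0<t    = *-positive 0<x (⁻¹-positive 0<8)
          t*8≈x  = /-cancelʳ (0<⇒≉0 0<8)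
          t≤1    = /-≤ 0<8 (≤-trans (x≤2t 0<1 ≤-refl) (≤-from-difference
                     (solve 0 (con (+ 1) :* (con (+ 2) :* (con (+ 2) :* con (+ 2))) :- con (+ 2) :* con (+ 1) := con (+ 6)) refl)
                     0≤6))
      in <⇒≱ 0<t (*-cancelˡ-≤ 0<6 (≤-from-difference
           (solve 1 (λ t → con (+ 6) :* con (+ 0) :- con (+ 6) :* t := con (+ 2) :* t :- t :* con (+ 8)) refl t)
           (x≤y⇒0≤y-x (≤-respˡ (sym (trans (*-congˡ (solve 0 (con (+ 8) := con (+ 2) :* (con (+ 2) :* con (+ 2))) refl)) t*8≈x))
             (x≤2t 0<t t≤1)))))
      where
      0<6 : 0# < ⟦ + 6 ⟧ᶻ
      0<6 = +-positive (+-positive (+-positive (+-positive (+-positive 0<1 0≤1) 0≤1) 0≤1) 0≤1) 0≤1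

      0≤6 : 0# ≤ ⟦ + 6 ⟧ᶻ
      0≤6 = proj₁ 0<6

-- Consequences of `x (1 + c²) ≤ 2c` for real numbers.

module MainInequalities (ℝ : CompleteOrderedField) where

  open CompleteOrderedField ℝ hiding (zero)
  open OrderedFieldProperties ℝ

  module _ {x c} (0≤c : 0# ≤ c) (c≤1 : c ≤ 1#) (x[1+c²]≤2c : x * (1# + c ²) ≤ 2# * c) where

    private
      0<1+ : ∀ y → 0# < 1# + y ²
      0<1+ y = +-positive 0<1 (²-nonNegative y)

    x≤2c : 0# ≤ x → x ≤ 2# * c
    x≤2c 0≤x = ≤-trans (≤-from-difference
      (solve 2 (λ x c → x :* (con (+ 1) :+ c :* c) :- x := x :* (c :* c)) refl x c)
      (*-nonNegative 0≤x (²-nonNegative c))) x[1+c²]≤2c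

    -- The negated claim rearranges to `σ (1 + c²) ≤ 1 - c²`. Squaring, with `σ² = 1 - ρ²` and
    -- `(1 + c²)² - (1 - c²)² = 4c²`, gives `2c ≤ ρ (1 + c²)`, hence `x ≤ ρ`.
    collision-lowerBound : ∀ ρ → 0# ≤ ρ → ρ ≤ 1# → ρ < x →
                           (1# - √ (1# - ρ ²)) / (1# + √ (1# - ρ ²)) < c ²
    collision-lowerBound ρ 0≤ρ ρ≤1 ρ<x = /-<-cross (+-positive 0<1 0≤σ) (≰⇒> λ c²[1+σ]≤1-σ →
      let σ[1+c²]≤1-c² = ≤-from-difference
            (solve 2 (λ s c → (con (+ 1) :- c :* c) :- s :* (con (+ 1) :+ c :* c) := (con (+ 1) :- s) :- c :* c :* (con (+ 1) :+ s)) refl σ c)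
            (x≤y⇒0≤y-x c²[1+σ]≤1-σ)
          squared = ²-mono-≤ (*-nonNegative 0≤σ (proj₁ (0<1+ c))) σ[1+c²]≤1-c²
          4c²≤ = ≤-from-difference
            (trans (solve 3 (λ r s c → r :* (con (+ 1) :+ c :* c) :* (r :* (con (+ 1) :+ c :* c)) :- con (+ 2) :* c :* (con (+ 2) :* c)
                      := (con (+ 1) :- c :* c) :* (con (+ 1) :- c :* c) :- (con (+ 1) :- r :* r) :* ((con (+ 1) :+ c :* c) :* (con (+ 1) :+ c :* c)))
                    refl ρ σ c)
              (+-congˡ (-‿cong (trans (*-congʳ (sym σ²≈)) (solve 2 (λ s b → s :* s :* (b :* b) := s :* b :* (s :* b)) refl σ _)))))
            (x≤y⇒0≤y-x squared)
          2c≤ = ²-cancel-≤ (*-nonNegative 0≤ρ (proj₁ (0<1+ c))) 4c²≤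
      in <⇒≱ ρ<x (*-cancelˡ-≤ (0<1+ c) (≤-respˡ (*-comm _ _) (≤-respʳ (*-comm _ _) (≤-trans x[1+c²]≤2c 2c≤)))))
      where
      σ : Carrier
      σ = √ (1# - ρ ²)

      0≤1-ρ² : 0# ≤ 1# - ρ ²
      0≤1-ρ² = x≤y⇒0≤y-x (≤-respʳ (*-identityˡ 1#) (²-mono-≤ 0≤ρ ρ≤1))

      0≤σ : 0# ≤ σ
      0≤σ = √-nonNegative 0≤1-ρ²

      σ²≈ : σ ² ≈ 1# - ρ ²
      σ²≈ = √²≈ 0≤1-ρ²

    -- Strict growth of `2c / (1 + c²)` on `[0, 1]`, in the form `s (1 + c²) - c (1 + s²) = (s - c)
    -- (1 - cs)`.
    x-upperBound : ∀ δ → 0# < δ → δ ≤ 1# → c ² < δ → x < (2# * √ δ) / (1# + δ)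
    x-upperBound δ 0<δ δ≤1 c²<δ = <-/-cross (+-positive 0<1 (proj₁ 0<δ)) (≰⇒> λ 2s≤x[1+δ] →
      <⇒≱ (*-positive 0<2 (*-positive (x<y⇒0<y-x c<s) (x<y⇒0<y-x cs<1)))
        (≤-from-difference
          (solve 3 (λ s c x → con (+ 0) :- con (+ 2) :* ((s :- c) :* (con (+ 1) :- c :* s))
             := (con (+ 1) :+ s :* s) :* (con (+ 2) :* c :- x :* (con (+ 1) :+ c :* c))
                :+ (con (+ 1) :+ c :* c) :* (x :* (con (+ 1) :+ s :* s) :- con (+ 2) :* s)) refl s c x)
          (+-nonNegative
            (*-nonNegative (proj₁ (0<1+ s)) (x≤y⇒0≤y-x x[1+c²]≤2c))
            (*-nonNegative (proj₁ (0<1+ c)) (x≤y⇒0≤y-x (≤-respʳ (*-congˡ (+-congˡ (sym s²≈δ))) 2s≤x[1+δ]))))))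
      where
      s : Carrier
      s = √ δ

      s²≈δ : s ² ≈ δ
      s²≈δ = √²≈ (proj₁ 0<δ)

      0≤s : 0# ≤ s
      0≤s = √-nonNegative (proj₁ 0<δ)

      c<s : c < s
      c<s = ≰⇒> λ s≤c → <⇒≱ c²<δ (≤-respˡ s²≈δ (²-mono-≤ 0≤s s≤c))

      s≤1 : s ≤ 1#
      s≤1 = ²-cancel-≤ 0≤1 (≤-respˡ (sym s²≈δ) (≤-respʳ (sym (*-identityˡ 1#)) δ≤1))

      cs<1 : c * s < 1#
      cs<1 = ≤-<-trans (≤-respʳ (*-identityʳ c) (*-monoˡ-≤ 0≤c s≤1)) (<-≤-trans c<s s≤1)

    -- If `1 - h ≤ x`, squaring gives `(1 - c²)² ≤ (2h - h²) (1 + c²)² ≤ 8h = ε²`, because `1 + c² ≤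
    -- 2`; this is how the constant 8 arises, as `2 · 2²`.
    x-upperBound-nearOne : ∀ ε → 0# ≤ ε → ε < 1# → c ² < 1# - ε → x < 1# - ε ² / 8#
    x-upperBound-nearOne ε 0≤ε ε<1 c²<1-ε = ≰⇒> λ 1-h≤x →
      let [1-h][1+c²]≤2c = ≤-trans (*-monoʳ-≤ (proj₁ (0<1+ c)) 1-h≤x) x[1+c²]≤2c
          squared = ²-mono-≤ (*-nonNegative (x≤y⇒0≤y-x h≤1) (proj₁ (0<1+ c))) [1-h][1+c²]≤2c
          [1-c²]²≤ε² = ≤-from-difference
            (trans (+-congʳ (sym h*8≈ε²)) (solve 2 (λ h c → let one = con (+ 1); two = con (+ 2); b = one :+ c :* c in
                h :* (two :* (two :* two)) :- (one :- c :* c) :* (one :- c :* c)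
                := (two :* c :* (two :* c) :- (one :- h) :* b :* ((one :- h) :* b))
                   :+ (h :* h :* (b :* b) :+ two :* h :* ((one :- c :* c) :* (two :+ b)))) refl h c))
            (+-nonNegative (x≤y⇒0≤y-x squared) (+-nonNegative
              (*-nonNegative (²-nonNegative h) (²-nonNegative _))
              (*-nonNegative (*-nonNegative 0≤2 0≤h) (*-nonNegative (x≤y⇒0≤y-x c²≤1) (+-nonNegative 0≤2 (proj₁ (0<1+ c)))))))
      in <⇒≱ c²<1-ε (≤-from-difference
           (solve 2 (λ c e → c :* c :- (con (+ 1) :- e) := e :- (con (+ 1) :- c :* c)) refl c ε)
           (x≤y⇒0≤y-x (²-cancel-≤ 0≤ε [1-c²]²≤ε²)))
      where
      1≤2 : 1# ≤ 2#
      1≤2 = ≤-respˡ (+-identityʳ 1#) (+-monoʳ-≤ 1# 0≤1)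

      h : Carrier
      h = ε ² / 8#

      h*8≈ε² : h * 8# ≈ ε ²
      h*8≈ε² = /-cancelʳ (0<⇒≉0 0<8)

      0≤h : 0# ≤ h
      0≤h = /-nonNegative (²-nonNegative ε) 0<8

      c²≤1 : c ² ≤ 1#
      c²≤1 = ≤-respʳ (*-identityˡ 1#) (²-mono-≤ 0≤c c≤1)

      h≤1 : h ≤ 1#
      h≤1 = /-≤ 0<8 (≤-respʳ (sym (*-identityˡ 8#)) (≤-trans (²-mono-≤ 0≤ε (proj₁ ε<1))
        (*-mono-≤ 0≤1 (*-nonNegative 0≤2 0≤2) 1≤2
          (≤-trans 1≤2 (≤-respˡ (*-identityʳ 2#) (*-monoˡ-≤ 0≤2 1≤2))))))

theorem1p10 :
    (ℝ : CompleteOrderedField) →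
    let open CompleteOrderedField ℝ
        open ProjectionGames ℝ
    in
    (G : ProjectionGame) →
    (∀ ρ → 0# ≤ ρ → ρ ≤ 1# → ρ < (val₊ G) ² →
      ((collisionValue G) ² ≤ val G) ×
      ((1# - √ (1# - ρ ²)) / (1# + √ (1# - ρ ²)) < (collisionValue G) ²)) ×
    (∀ δ → 0# < δ → δ ≤ 1# → (collisionValue G) ² < δ →
      (val₊ G) ² < (2# * √ δ) / (1# + δ)) ×
    ((val₊ G) ² ≤ 2# * collisionValue G) ×
    (∀ ε → 0# ≤ ε → ε < 1# → (collisionValue G) ² < 1# - ε →
      (val₊ G) ² < 1# - ε ² / 8#)
theorem1p10 ℝ G =
  (λ ρ 0≤ρ ρ≤1 ρ<val₊² → collisionValue²≤val , collision-lowerBound 0≤c c≤1 main ρ 0≤ρ ρ≤1 ρ<val₊²) ,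
  x-upperBound 0≤c c≤1 main ,
  x≤2c 0≤c c≤1 main (²-nonNegative _) ,
  x-upperBound-nearOne 0≤c c≤1 main
  where
  open OrderedFieldProperties ℝ using (²-nonNegative)
  open MainInequalities ℝ
  open GameValues ℝ G
    renaming (collisionValue-nonNegative to 0≤c; collisionValue≤1 to c≤1; val₊²-collisionValue to main)
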